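{- For every $n\ge1$, the restriction of $\pi_\downarrow^{3412}$ is an isomorphism of posets from the weak order on $S_n$ restricted to Baxter permutations to the weak order on $S_n$ restricted to twisted Baxter permutations. The inverse isomorphism is (the restriction of) $\pi^\uparrow_{3412}$. In particular, the weak order restricted to Baxter permutations in $S_n$ is a lattice.
   Context: Permutations are in one-line notation $x=x_1\cdots x_n\in S_n$. Patterns, always with $a<b<c<d$: $x$ contains 3-41-2 if it has a subsequence $c\,d\,a\,b$ with $d$ immediately before $a$ in $x$; 2-41-3 if it has a subsequence $b\,d\,a\,c$ with $d$ immediately before $a$; 3-14-2 if it has a subsequence $c\,a\,d\,b$ with $a$ immediately before $d$. A Baxter permutation is one avoiding both 3-14-2 and 2-41-3; a twisted Baxter permutation is one avoiding both 3-41-2 and 2-41-3. The weak order on $S_n$ is the partial order in which one moves up by a cover by swapping adjacent entries $x_i<x_{i+1}$; it is a lattice. Restricting it to a subset means taking the induced subposet. A permutation $x$ is obtained from $y$ by a $(3412\to3142)$-move if $y$ has a subsequence $c\,d\,a\,b$ as in the pattern 3-41-2 and $x$ is $y$ with the adjacent entries $d,a$ swapped. $\Theta_{3412}$ is the lattice congruence on the weak order on $S_n$ such that, for a cover $x\lessdot y$, $x\equiv y$ if and only if $x$ is obtained from $y$ by a $(3412\to3142)$-move; its classes are intervals, so it is the equivalence relation generated by these moves (that it is a lattice congruence is known). $\pi_\downarrow^{3412}$ sends a permutation to the minimal element of its $\Theta_{3412}$-class, and $\pi^\uparrow_{3412}$ sends it to the maximal element of its class. -}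

module Defs where

open import Data.Fin.Base using (Fin; toℕ; _<_)
open import Data.Fin.Permutation
  using (Permutation′; _⟨$⟩ʳ_; _≈_; _∘ₚ_; transpose)
open import Data.Nat.Base using (ℕ; suc)
open import Data.Product.Base using (_×_; ∃; ∃-syntax; proj₁)
open import Function.Base using (_on_)
open import Level using (0ℓ)
open import Relation.Binary.Construct.Closure.Equivalence using (EqClosure)
open import Relation.Binary.Construct.Closure.ReflexiveTransitive using (Star)
open import Relation.Binary.Construct.Union using (_∪_)
open import Relation.Binary.Core using (Rel)
open import Relation.Nullary.Negation.Core using (¬_)
open import Relation.Binary.PropositionalEquality.Core using (_≡_)
open import Relation.Unary using (Pred)

private
  variable
    n : ℕ

-- A permutation x has the one-line notation whose entry at position i is
-- x ⟨$⟩ʳ i; permutations are compared by the pointwise equality _≈_.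

infix 4 _⋖ₚ_ _⋖_ _≤ʷ_ _⟶_ _≡Θ_

_⋖ₚ_ : Rel (Fin n) 0ℓ
i ⋖ₚ j = toℕ j ≡ suc (toℕ i)

-- Precomposing x with a transposition of positions swaps two entries of x.
swapEntries : Fin n → Fin n → Permutation′ n → Permutation′ n
swapEntries i j x = transpose i j ∘ₚ x

_⋖_ : Rel (Permutation′ n) 0ℓ
x ⋖ y = ∃[ i ] ∃[ j ] i ⋖ₚ j × x ⟨$⟩ʳ i < x ⟨$⟩ʳ j × y ≈ swapEntries i j x

-- The weak order.  Including _≈_ makes it reflexive up to _≈_.
_≤ʷ_ : Rel (Permutation′ n) 0ℓ
_≤ʷ_ = Star (_≈_ ∪ _⋖_)

-- In the following patterns the arguments i, j, k, l are the positions of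
-- the four entries, listed from left to right.

Is3-41-2 : Permutation′ n → (i j k l : Fin n) → Set
Is3-41-2 x i j k l =
  i < j × j ⋖ₚ k × k < l ×
  x ⟨$⟩ʳ k < x ⟨$⟩ʳ l × x ⟨$⟩ʳ l < x ⟨$⟩ʳ i × x ⟨$⟩ʳ i < x ⟨$⟩ʳ j

Is2-41-3 : Permutation′ n → (i j k l : Fin n) → Set
Is2-41-3 x i j k l =
  i < j × j ⋖ₚ k × k < l ×
  x ⟨$⟩ʳ k < x ⟨$⟩ʳ i × x ⟨$⟩ʳ i < x ⟨$⟩ʳ l × x ⟨$⟩ʳ l < x ⟨$⟩ʳ j

Is3-14-2 : Permutation′ n → (i j k l : Fin n) → Set
Is3-14-2 x i j k l =
  i < j × j ⋖ₚ k × k < l ×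
  x ⟨$⟩ʳ j < x ⟨$⟩ʳ l × x ⟨$⟩ʳ l < x ⟨$⟩ʳ i × x ⟨$⟩ʳ i < x ⟨$⟩ʳ k

Avoids : (Permutation′ n → (i j k l : Fin n) → Set) → Pred (Permutation′ n) 0ℓ
Avoids P x = ¬ (∃[ i ] ∃[ j ] ∃[ k ] ∃[ l ] P x i j k l)

Baxter : Pred (Permutation′ n) 0ℓ
Baxter x = Avoids Is3-14-2 x × Avoids Is2-41-3 x

TwistedBaxter : Pred (Permutation′ n) 0ℓ
TwistedBaxter x = Avoids Is3-41-2 x × Avoids Is2-41-3 x

-- y ⟶ x: x is obtained from y by a (3412 → 3142)-move.
_⟶_ : Rel (Permutation′ n) 0ℓ
y ⟶ x = ∃[ i ] ∃[ j ] ∃[ k ] ∃[ l ] Is3-41-2 y i j k l × x ≈ swapEntries j k y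

-- The congruence Θ₃₄₁₂, as the equivalence relation generated by the moves.
_≡Θ_ : Rel (Permutation′ n) 0ℓ
_≡Θ_ = EqClosure (_≈_ ∪ _⟶_)

-- The classes of _≡Θ_ are intervals, so the minimal and the maximal element
-- of a class are its least and greatest elements.

Isπ↓ : (Permutation′ n → Permutation′ n) → Set
Isπ↓ π = ∀ x → π x ≡Θ x × (∀ y → y ≡Θ x → π x ≤ʷ y)

Isπ↑ : (Permutation′ n → Permutation′ n) → Set
Isπ↑ π = ∀ x → π x ≡Θ x × (∀ y → y ≡Θ x → y ≤ʷ π x)

infix 8 _↾_
_↾_ : Rel (Permutation′ n) 0ℓ → (P : Pred (Permutation′ n) 0ℓ) → Rel (∃ P) 0ℓ
R ↾ P = R on proj₁

{-# OPTIONS --safe #-}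
module Submission where

-- Permutations are ordered by containment of inversion sets.  An inversion (a , d)
-- is unsplit if no value strictly between a and d is placed between d and a.
-- The unsplit inversions generate all inversions, and every unsplit inversion
-- straddles a descent d′ a′ with a′ ≤ a < d ≤ d′, so a pattern-avoidance condition
-- on descents passes to all unsplit inversions.
--
-- For the patterns 3-41-2 and 2-41-3 there is a condition D w a d, increasing in w,
-- which holds at the unsplit inversions (a , d) around which the pattern is absent
-- and which is unchanged by the moves that destroy the pattern.  Hence the inversions
-- of an avoiding z are generated by D z, so z lies below each y with D z ⊆ D y.
-- This makes the end of any maximal chain of (3412 → 3142)-moves the least
-- element of its class, and makes π↓ monotone.  Reversing the one-line notation
-- turns the inverse moves into (2413 → 2143)-moves and so gives π↑ in the same way.
--
-- An avoider of 2-41-3 stays one under π↓, and from twisted Baxter permutations under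
-- π↑, since an occurrence produced on one side would be an unsplit occurrence on the other.
--
-- The conditions D also show that joins of avoiders are avoiders.  The Baxter join of x and y is
-- then π↑ of the join of π↓ x and π↓ y, and meets follow because reversal is an
-- anti-automorphism that preserves Baxter permutations.

open import Defs
open import Algebra.Core using (Op₂)
open import Data.Empty using (⊥)
open import Data.Fin.Base 
  using (Fin; zero; suc; toℕ; fromℕ<; inject₁; opposite; combine; remQuot; _<_; _≤_; _>_)
open import Data.Fin.Induction using (<-wellFounded; >-wellFounded)
open import Data.Fin.Permutation
  using (Permutation′; _≈_; _⟨$⟩ʳ_; _⟨$⟩ˡ_; _∘ₚ_; inverseˡ; inverseʳ; reverse)
import Data.Fin.Permutation.Components as PC
open import Data.Fin.Properties
  using (_≟_; _<?_; _≤?_; any?; toℕ-injective; toℕ<n; toℕ-fromℕ<; toℕ-inject₁; <-cmp; <⇒≢; ≤∧≢⇒<; opposite-prop;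
         opposite-involutive; remQuot-combine)
open import Data.Fin.Subset using (Subset; _∈_; _⊂_)
open import Data.Fin.Subset.Induction using (⊂-wellFounded)
open import Data.Nat.Base as ℕ using (ℕ; _≥_)
import Data.Nat.Properties as ℕ
open import Data.Product.Base using (_×_; _,_; ∃; ∃₂; ∃-syntax; Σ-syntax; map; swap; proj₁; proj₂)
open import Data.Sum.Base as Sum using (_⊎_; inj₁; inj₂; [_,_]′)
open import Data.Vec.Base using (tabulate)
open import Data.Vec.Properties using (lookup∘tabulate; lookup⇒[]=; []=⇒lookup)
open import Function.Base using (_∘_; id; flip; _on_)
open import Function.Definitions using (Inverseᵇ)
open import Induction.WellFounded using (Acc; acc)
open import Level using (0ℓ)
open import Relation.Binary.Construct.Closure.ReflexiveTransitive using (Star; ε; _◅_; _◅◅_)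
open import Relation.Binary.Construct.Closure.Symmetric using (SymClosure; fwd; bwd)
import Relation.Binary.Construct.Closure.Equivalence as EqClosure
import Relation.Binary.Construct.On as On
open import Relation.Binary.Core using (Rel)
open import Relation.Binary.Definitions using (tri<; tri≈; tri>)
open import Relation.Binary.Lattice.Definitions using (Supremum; Infimum)
open import Relation.Binary.Lattice.Structures using (IsLattice)
open import Relation.Binary.Morphism.Structures using (IsOrderIsomorphism)
open import Relation.Binary.Structures using (IsPartialOrder)
open import Relation.Binary.PropositionalEquality
  using (_≡_; _≢_; refl; sym; trans; cong; cong₂; subst; subst₂)
open import Relation.Nullary
  using (¬_; Dec; yes; no; does; contradiction; ¬?; _×-dec_)
open import Relation.Nullary.Decidable using (dec-true; dec-false; decidable-stable)
open import Relation.Unary using (Pred; Decidable)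

private
  variable
    n : ℕ
    u v : Fin n
    w x y z : Permutation′ n

-- Consecutive elements of Fin n

⋖ₚ⇒< : ∀ {i j : Fin n} → i ⋖ₚ j → i < j
⋖ₚ⇒< i⋖j = ℕ.≤-reflexive (sym i⋖j)

<⋖ₚ⇒≤ : ∀ {t i j : Fin n} → i ⋖ₚ j → t < j → t ≤ i
<⋖ₚ⇒≤ {t = t} i⋖j t<j = ℕ.s≤s⁻¹ (subst (ℕ.suc (toℕ t) ℕ.≤_) i⋖j t<j)

⋖ₚ<⇒≤ : ∀ {t i j : Fin n} → i ⋖ₚ j → i < t → j ≤ t
⋖ₚ<⇒≤ {t = t} i⋖j i<t = subst (ℕ._≤ toℕ t) (sym i⋖j) i<t

predecessor : ∀ {i j : Fin n} → i < j → ∃[ k ] k ⋖ₚ j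
predecessor {j = suc k} _ = inject₁ k , cong ℕ.suc (sym (toℕ-inject₁ k))

successor : ∀ {i j : Fin n} → i < j → ∃[ k ] i ⋖ₚ k
successor {j = j} i<j =
  fromℕ< (ℕ.≤-<-trans i<j (toℕ<n j)) , toℕ-fromℕ< (ℕ.≤-<-trans i<j (toℕ<n j))

module _ {P : Pred (Fin n) 0ℓ} (P? : Decidable P) where

  lastHolding : ∀ {i j} → i < j → P i → ¬ P j →
                ∃[ k ] i ≤ k × k < j × P k × (∀ t → k < t → t ≤ j → ¬ P t)
  lastHolding {i} i<j Pi ¬Pj = search (<-wellFounded _) i<j ¬Pj
    where
    search : ∀ {j} → Acc _<_ j → i < j → ¬ P j →
             ∃[ k ] i ≤ k × k < j × P k × (∀ t → k < t → t ≤ j → ¬ P t)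
    search {j} (acc rs) i<j ¬Pj with predecessor i<j
    ... | j′ , j′⋖j with P? j′
    ...   | yes Pj′ = j′ , <⋖ₚ⇒≤ j′⋖j i<j , ⋖ₚ⇒< j′⋖j , Pj′ , λ t j′<t t≤j →
            subst (¬_ ∘ P) (toℕ-injective (ℕ.≤-antisym (⋖ₚ<⇒≤ j′⋖j j′<t) t≤j)) ¬Pj
    ...   | no ¬Pj′
      with k , i≤k , k<j′ , Pk , rest ←
        search (rs (⋖ₚ⇒< j′⋖j))
          (≤∧≢⇒< (<⋖ₚ⇒≤ j′⋖j i<j) (λ { refl → ¬Pj′ Pi })) ¬Pj′
      = k , i≤k , ℕ.<-trans k<j′ (⋖ₚ⇒< j′⋖j) , Pk , beyond
      where
      beyond : ∀ t → k < t → t ≤ j → ¬ P t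
      beyond t k<t t≤j with t ≟ j
      ... | yes refl = ¬Pj
      ... | no t≢j   = rest t k<t (<⋖ₚ⇒≤ j′⋖j (≤∧≢⇒< t≤j t≢j))

  firstFailing : ∀ {i j} → i < j → P i → ¬ P j →
                 ∃[ k ] i < k × k ≤ j × ¬ P k × (∀ t → i ≤ t → t < k → P t)
  firstFailing {j = j} i<j Pi ¬Pj = search (>-wellFounded _) i<j Pi
    where
    search : ∀ {i} → Acc _>_ i → i < j → P i →
             ∃[ k ] i < k × k ≤ j × ¬ P k × (∀ t → i ≤ t → t < k → P t)
    search {i} (acc rs) i<j Pi with successor i<j
    ... | i′ , i⋖i′ with P? i′
    ...   | no ¬Pi′ = i′ , ⋖ₚ⇒< i⋖i′ , ⋖ₚ<⇒≤ i⋖i′ i<j , ¬Pi′ , λ t i≤t t<i′ →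
            subst P (toℕ-injective (ℕ.≤-antisym i≤t (<⋖ₚ⇒≤ i⋖i′ t<i′))) Pi
    ...   | yes Pi′
      with k , i′<k , k≤j , ¬Pk , rest ←
        search (rs (⋖ₚ⇒< i⋖i′))
          (≤∧≢⇒< (⋖ₚ<⇒≤ i⋖i′ i<j) (λ { refl → ¬Pj Pi′ })) Pi′
      = k , ℕ.<-trans (⋖ₚ⇒< i⋖i′) i′<k , k≤j , ¬Pk , before
      where
      before : ∀ t → i ≤ t → t < k → P t
      before t i≤t t<k with i ≟ t
      ... | yes refl = Pi
      ... | no i≢t   = rest t (⋖ₚ<⇒≤ i⋖i′ (≤∧≢⇒< i≤t i≢t)) t<k

  crossing : ∀ {i j} → i < j → P i → ¬ P j →
             ∃[ k ] ∃[ l ] k ⋖ₚ l × i ≤ k × l ≤ j × P k × ¬ P l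
  crossing i<j Pi ¬Pj
    with k , i≤k , k<j , Pk , rest ← lastHolding i<j Pi ¬Pj
    with l , k⋖l ← successor k<j
    = k , l , k⋖l , i≤k , ⋖ₚ<⇒≤ k⋖l k<j , Pk , rest l (⋖ₚ⇒< k⋖l) (⋖ₚ<⇒≤ k⋖l k<j)

-- Permutations as linear orders on their entries

pos : Permutation′ n → Fin n → Fin n
pos = _⟨$⟩ˡ_

Before : Permutation′ n → Rel (Fin n) 0ℓ
Before w u v = pos w u < pos w v

Before? : ∀ (w : Permutation′ n) u v → Dec (Before w u v)
Before? w u v = pos w u <? pos w v

Adjacent : Permutation′ n → Rel (Fin n) 0ℓ
Adjacent w u v = pos w u ⋖ₚ pos w v

pos-injective : ∀ (w : Permutation′ n) → pos w u ≡ pos w v → u ≡ v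
pos-injective w eq = trans (sym (inverseʳ w)) (trans (cong (w ⟨$⟩ʳ_) eq) (inverseʳ w))

pos-cong : x ≈ y → pos x u ≡ pos y u
pos-cong {x = x} {y = y} {u = u} x≈y =
  trans (cong (pos x) (trans (sym (inverseʳ y)) (sym (x≈y (pos y u))))) (inverseˡ x)

before-cong : x ≈ y → Before x u v → Before y u v
before-cong {x = x} {y = y} x≈y = subst₂ _<_ (pos-cong {x = x} {y} x≈y) (pos-cong {x = x} {y} x≈y)

¬before⇒after : ∀ (w : Permutation′ n) → u ≢ v → ¬ Before w u v → Before w v u
¬before⇒after w u≢v u≮v =
  ≤∧≢⇒< (ℕ.≮⇒≥ u≮v) (u≢v ∘ sym ∘ pos-injective w)

<⇒≢′ : u < v → v ≢ u
<⇒≢′ u<v refl = ℕ.<-irrefl refl u<v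

private
  inflationary : (f : Fin n → Fin n) → (∀ {i j} → i < j → f i < f j) → ∀ i → i ≤ f i
  inflationary f f-mono i = go i (<-wellFounded i)
    where
    go : ∀ i → Acc _<_ i → i ≤ f i
    go zero _ = ℕ.z≤n
    go i@(suc _) (acc rs) with predecessor {i = Fin.zero} {j = i} (ℕ.s≤s ℕ.z≤n)
    ... | k , k⋖i = subst (ℕ._≤ toℕ (f i)) (sym k⋖i)
                      (ℕ.≤-<-trans (go k (rs (⋖ₚ⇒< k⋖i))) (f-mono (⋖ₚ⇒< k⋖i)))

-- Totality of `Before` turns the implication into an equivalence. Hence reading an entry of `x` and
-- locating it in `y`, and the same with `x` and `y` exchanged, are strictly increasing self-maps of
-- `Fin n`. Both are inflationary and they are mutually inverse, so both are the identity.
before-determines : (∀ u v → Before x u v → Before y u v) → x ≈ y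
before-determines {x = x} {y = y} x⇒y i =
  trans (sym (inverseʳ y)) (cong (y ⟨$⟩ʳ_) (toℕ-injective (ℕ.≤-antisym f≤ f≥)))
  where
  y⇒x : ∀ u v → Before y u v → Before x u v
  y⇒x u v u<v = ¬before⇒after x (λ { refl → ℕ.<-irrefl refl u<v }) (ℕ.<-asym u<v ∘ x⇒y v u)

  position-mono : ∀ (p q : Permutation′ _) → (∀ u v → Before p u v → Before q u v) →
                  ∀ {i j} → i < j → pos q (p ⟨$⟩ʳ i) < pos q (p ⟨$⟩ʳ j)
  position-mono p q p⇒q i<j =
    p⇒q _ _ (subst₂ _<_ (sym (inverseˡ p)) (sym (inverseˡ p)) i<j)

  f≥ : i ≤ pos y (x ⟨$⟩ʳ i)
  f≥ = inflationary _ (position-mono x y x⇒y) i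

  f≤ : pos y (x ⟨$⟩ʳ i) ≤ i
  f≤ = subst (pos y (x ⟨$⟩ʳ i) ≤_) (trans (cong (pos x) (inverseʳ y)) (inverseˡ x))
         (inflationary _ (position-mono y x y⇒x) (pos y (x ⟨$⟩ʳ i)))

-- Containment of inversion sets

infix 4 _⊑_
_⊑_ : Rel (Permutation′ n) 0ℓ
x ⊑ y = ∀ a d → a < d → Before x d a → Before y d a

⊑-noninversion : x ⊑ y → u < v → Before y u v → Before x u v
⊑-noninversion {x = x} x⊑y u<v uv =
  ¬before⇒after x (<⇒≢′ u<v) (ℕ.<-asym uv ∘ x⊑y _ _ u<v)

⊑-reflexive : x ≈ y → x ⊑ y
⊑-reflexive {x = x} {y = y} x≈y _ _ _ = before-cong {x = x} {y = y} x≈y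

⊑-trans : x ⊑ y → y ⊑ z → x ⊑ z
⊑-trans x⊑y y⊑z a d a<d = y⊑z a d a<d ∘ x⊑y a d a<d

⊑-antisym : x ⊑ y → y ⊑ x → x ≈ y
⊑-antisym {x = x} {y = y} x⊑y y⊑x = before-determines {x = x} {y = y} x⇒y
  where
  x⇒y : ∀ u v → Before x u v → Before y u v
  x⇒y u v uv with <-cmp u v
  ... | tri< u<v _ _ = ⊑-noninversion {x = y} {y = x} y⊑x u<v uv
  ... | tri≈ _ refl _ = contradiction uv (ℕ.<-irrefl refl)
  ... | tri> _ _ v<u = x⊑y v u v<u uv

-- Removing the inversion of two adjacent entries

transposeˡ : ∀ (i j : Fin n) → PC.transpose i j i ≡ j
transposeˡ i j rewrite dec-true (i ≟ i) refl = refl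

transposeʳ : ∀ (i j : Fin n) → PC.transpose i j j ≡ i
transposeʳ i j with j ≟ i
... | yes j≡i = j≡i
... | no _ rewrite dec-true (j ≟ j) refl = refl

transpose-other : ∀ {i j k : Fin n} → k ≢ i → k ≢ j → PC.transpose i j k ≡ k
transpose-other {i = i} {j} {k} k≢i k≢j
  rewrite dec-false (k ≟ i) k≢i | dec-false (k ≟ j) k≢j = refl

transpose-comm : ∀ (i j k : Fin n) → PC.transpose i j k ≡ PC.transpose j i k
transpose-comm i j k = cases (k ≟ i) (k ≟ j)
  where
  cases : Dec (k ≡ i) → Dec (k ≡ j) → PC.transpose i j k ≡ PC.transpose j i k
  cases (yes refl) _        = trans (transposeˡ i j) (sym (transposeʳ j i))
  cases (no _) (yes refl)   = trans (transposeʳ i j) (sym (transposeˡ j i))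
  cases (no k≢i) (no k≢j)   = trans (transpose-other k≢i k≢j) (sym (transpose-other k≢j k≢i))

transpose-involutive : ∀ (i j k : Fin n) → PC.transpose i j (PC.transpose i j k) ≡ k
transpose-involutive i j k =
  trans (cong (PC.transpose i j) (transpose-comm i j k)) (PC.transpose-inverse i j)

transpose-mono : ∀ {i j p q : Fin n} → i ⋖ₚ j → p < q → ¬ (p ≡ i × q ≡ j) →
                 PC.transpose j i p < PC.transpose j i q
transpose-mono {i = i} {j} {p} {q} i⋖j p<q pq≢ij = cases (p ≟ j) (p ≟ i) (q ≟ j) (q ≟ i)
  where
  i<j = ⋖ₚ⇒< i⋖j

  to : ∀ {p′ q′} → PC.transpose j i p ≡ p′ → PC.transpose j i q ≡ q′ → p′ < q′ →
       PC.transpose j i p < PC.transpose j i q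
  to p≡ q≡ = subst₂ _<_ (sym p≡) (sym q≡)

  cases : Dec (p ≡ j) → Dec (p ≡ i) → Dec (q ≡ j) → Dec (q ≡ i) →
          PC.transpose j i p < PC.transpose j i q
  cases (yes refl) _ (yes refl) _ = contradiction p<q (ℕ.<-irrefl refl)
  cases (yes refl) _ (no _) (yes refl) = contradiction p<q (ℕ.<-asym i<j)
  cases (yes refl) _ (no q≢j) (no q≢i) =
    to (transposeˡ j i) (transpose-other q≢j q≢i) (ℕ.<-trans i<j p<q)
  cases (no _) (yes refl) (yes refl) _ = contradiction (refl , refl) pq≢ij
  cases (no _) (yes refl) (no _) (yes refl) = contradiction p<q (ℕ.<-irrefl refl)
  cases (no _) (yes refl) (no q≢j) (no q≢i) =
    to (transposeʳ j i) (transpose-other q≢j q≢i) (≤∧≢⇒< (⋖ₚ<⇒≤ i⋖j p<q) (q≢j ∘ sym))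
  cases (no p≢j) (no p≢i) (yes refl) _ =
    to (transpose-other p≢j p≢i) (transposeˡ j i) (≤∧≢⇒< (<⋖ₚ⇒≤ i⋖j p<q) p≢i)
  cases (no p≢j) (no p≢i) (no _) (yes refl) =
    to (transpose-other p≢j p≢i) (transposeʳ j i) (ℕ.<-trans p<q i<j)
  cases (no p≢j) (no p≢i) (no q≢j) (no q≢i) =
    to (transpose-other p≢j p≢i) (transpose-other q≢j q≢i) p<q

-- The interchange of adjacent entries `d a` told through relative order alone; `swap-drops` and
-- `drops-swap` translate from and to `swapEntries`. In this form it combines directly with
-- inversion containment and with reversal.
record Drops (y x : Permutation′ n) (a d : Fin n) : Set where
  field
    a<d      : a < d
    adjacent : Adjacent y d a
    keep     : ∀ u v → Before y u v → (u ≡ d × v ≡ a) ⊎ Before x u v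
    new      : Before x a d

  restore : ∀ u v → Before x u v → (u ≡ a × v ≡ d) ⊎ Before y u v
  restore u v uv with Before? y u v
  ... | yes uv′ = inj₂ uv′
  ... | no ¬uv with keep v u (¬before⇒after y (λ { refl → ℕ.<-irrefl refl uv }) ¬uv)
  ...   | inj₁ (v≡d , u≡a) = inj₁ (u≡a , v≡d)
  ...   | inj₂ vu = contradiction uv (ℕ.<-asym vu)

  drop⇒⊑ : x ⊑ y
  drop⇒⊑ b c b<c cb with restore c b cb
  ... | inj₁ (refl , refl) = contradiction b<c (ℕ.<-asym a<d)
  ... | inj₂ cb′ = cb′

swap-drops : ∀ {a d} → a < d → Adjacent y d a →
             x ≈ swapEntries (pos y d) (pos y a) y → Drops y x a d
swap-drops {y = y} {x = x} {a} {d} a<d da x≈s = record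
  { a<d = a<d
  ; adjacent = da
  ; keep = keep
  ; new = before-cong {x = s} {y = x} (sym ∘ x≈s)
            (subst₂ _<_ (sym (transposeˡ (pos y a) (pos y d))) (sym (transposeʳ (pos y a) (pos y d))) (⋖ₚ⇒< da))
  }
  where
  s = swapEntries (pos y d) (pos y a) y
  keep : ∀ u v → Before y u v → (u ≡ d × v ≡ a) ⊎ Before x u v
  keep u v uv with u ≟ d ×-dec v ≟ a
  ... | yes eqs = inj₁ eqs
  ... | no ≢da = inj₂ (before-cong {x = s} {y = x} (sym ∘ x≈s)
          (transpose-mono da uv (≢da ∘ map (pos-injective y) (pos-injective y))))

drops-swap : ∀ {a d} → Drops y x a d → x ≈ swapEntries (pos y d) (pos y a) y
drops-swap {y = y} {x = x} {a} {d} drop = sym ∘ before-determines {x = s} {y = x} s⇒x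
  where
  open Drops drop
  s = swapEntries (pos y d) (pos y a) y
  module S = Drops (swap-drops {y = y} {x = s} a<d adjacent (λ _ → refl))
  s⇒x : ∀ u v → Before s u v → Before x u v
  s⇒x u v uv with S.restore u v uv
  ... | inj₁ (refl , refl) = new
  ... | inj₂ uv′ with keep u v uv′
  ...   | inj₁ (refl , refl) = contradiction uv (ℕ.<-asym S.new)
  ...   | inj₂ uv″ = uv″

drops-⋖ : ∀ {a d} → Drops y x a d → x ⋖ y
drops-⋖ {y = y} {x = x} {a} {d} drop =
  i , j , adjacent ,
  subst₂ _<_ (sym (trans (x≈s i) (trans (cong (y ⟨$⟩ʳ_) (transposeˡ i j)) (inverseʳ y))))
             (sym (trans (x≈s j) (trans (cong (y ⟨$⟩ʳ_) (transposeʳ i j)) (inverseʳ y)))) a<d ,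
  λ k → sym (trans (x≈s (PC.transpose i j k)) (cong (y ⟨$⟩ʳ_) (transpose-involutive i j k)))
  where
  open Drops drop
  i = pos y d
  j = pos y a
  x≈s = drops-swap {y = y} {x = x} drop

-- Descending in the weak order

module _ {P : Pred (Fin n) 0ℓ} (P? : Decidable P) where

  subset : Subset n
  subset = tabulate (does ∘ P?)

  ∈-subset⁺ : ∀ {i} → P i → i ∈ subset
  ∈-subset⁺ {i} Pi = lookup⇒[]= i subset (trans (lookup∘tabulate (does ∘ P?) i) (dec-true (P? i) Pi))

  ∈-subset⁻ : ∀ {i} → i ∈ subset → P i
  ∈-subset⁻ {i} i∈ with P? i | trans (sym (lookup∘tabulate (does ∘ P?) i)) ([]=⇒lookup i∈)
  ... | yes Pi | _ = Pi

Inversion : Permutation′ n → Pred (Fin n × Fin n) 0ℓ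
Inversion w (a , d) = a < d × Before w d a

inversion? : ∀ (w : Permutation′ n) → Decidable (Inversion w)
inversion? w (a , d) = a <? d ×-dec Before? w d a

-- Coding pairs of entries in a single `Fin` makes strict inclusion of inversion sets well-founded,
-- which terminates every descent below.
inversions : Permutation′ n → Subset (n ℕ.* n)
inversions {n} w = subset (inversion? w ∘ remQuot n)

_⊏_ : Rel (Permutation′ n) 0ℓ
_⊏_ = _⊂_ on inversions

drops-⊏ : ∀ {a d} → Drops y x a d → x ⊏ y
drops-⊏ {n} {y} {x} {a} {d} drop =
  (λ k∈ → ∈-subset⁺ (inversion? y ∘ remQuot n)
            (let b<c , cb = ∈-subset⁻ (inversion? x ∘ remQuot n) k∈ in b<c , drop⇒⊑ _ _ b<c cb)) ,
  combine a d ,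
  ∈-subset⁺ (inversion? y ∘ remQuot n)
    (subst (Inversion y) (sym (remQuot-combine a d)) (a<d , ⋖ₚ⇒< adjacent)) ,
  λ ad∈ → ℕ.<-asym new
    (proj₂ (subst (Inversion x) (remQuot-combine a d) (∈-subset⁻ (inversion? x ∘ remQuot n) ad∈)))
  where open Drops drop

-- `S` selects the descents that may be removed. With `Occurs Q` the descents compute the
-- projections; with the inversions that two given permutations lack they compute joins.
module Descent (S : Permutation′ n → Rel (Fin n) 0ℓ) (S? : ∀ w a d → Dec (S w a d)) where

  Step : Rel (Permutation′ n) 0ℓ
  Step y x = ∃[ a ] ∃[ d ] Drops y x a d × S y a d

  Terminal : Pred (Permutation′ n) 0ℓ
  Terminal w = ∀ a d → a < d → Adjacent w d a → ¬ S w a d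

  descend : ∀ y → ∃[ x ] Star Step y x × Terminal x
  descend y = go y (On.wellFounded inversions ⊂-wellFounded y)
    where
    go : ∀ y → Acc _⊏_ y → ∃[ x ] Star Step y x × Terminal x
    go y (acc rs)
      with any? (λ a → any? (λ d → a <? d ×-dec toℕ (pos y a) ℕ.≟ ℕ.suc (toℕ (pos y d)) ×-dec S? y a d))
    ... | no none = y , ε , λ a d a<d da s → none (a , d , a<d , da , s)
    ... | yes (a , d , a<d , da , s) =
      let x = swapEntries (pos y d) (pos y a) y
          drop = swap-drops {y = y} {x = x} a<d da (λ _ → refl)
          z , steps , terminal = go x (rs (drops-⊏ {y = y} {x = x} drop))
      in z , (a , d , drop , s) ◅ steps , terminal

  steps⇒≤ʷ : Star Step y x → x ≤ʷ y
  steps⇒≤ʷ ε = ε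
  steps⇒≤ʷ ((_ , _ , drop , _) ◅ steps) = steps⇒≤ʷ steps ◅◅ inj₂ (drops-⋖ drop) ◅ ε

-- Unsplit inversions and the descents they straddle

Unsplit : Permutation′ n → Rel (Fin n) 0ℓ
Unsplit w d a = ∀ g → a < g → g < d → Before w g d ⊎ Before w a g

-- An entry `g` splitting `(a , d)` gives the two inversions `(a , g)` and `(g , d)`, which
-- `T-trans` composes. The recursion is on a bound `k` for the difference of `d` and `a`, which is
-- smaller for both halves.
unsplit-generate : ∀ (w : Permutation′ n) {T : Rel (Fin n) 0ℓ} →
                   (∀ {a g d} → T a g → T g d → T a d) →
                   (∀ a d → a < d → Before w d a → Unsplit w d a → T a d) →
                   ∀ a d → a < d → Before w d a → T a d
unsplit-generate w {T} T-trans base a d a<d da = go (toℕ d) a d (ℕ.m≤m+n _ _) a<d da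
  where
  go : ∀ k a d → toℕ d ℕ.≤ k ℕ.+ toℕ a → a < d → Before w d a → T a d
  go ℕ.zero a d d≤a a<d _ = contradiction a<d (ℕ.≤⇒≯ d≤a)
  go (ℕ.suc k) a d d≤ a<d da
    with any? (λ g → (a <? g ×-dec g <? d) ×-dec (Before? w d g ×-dec Before? w g a))
  ... | yes (g , (a<g , g<d) , dg , ga) =
    T-trans (go k a g (ℕ.s≤s⁻¹ (ℕ.≤-trans g<d d≤)) a<g ga)
            (go k g d (ℕ.≤-trans d≤ (subst (ℕ._≤ k ℕ.+ toℕ g) (ℕ.+-suc k (toℕ a)) (ℕ.+-monoʳ-≤ k a<g))) g<d dg)
  ... | no none = base a d a<d da unsplit
    where
    unsplit : Unsplit w d a
    unsplit g a<g g<d with Before? w d g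
    ... | no ¬dg = inj₁ (¬before⇒after w (<⇒≢′ g<d) ¬dg)
    ... | yes dg = inj₂ (¬before⇒after w (<⇒≢′ a<g) (λ ga → none (g , (a<g , g<d) , dg , ga)))

record Straddle (w : Permutation′ n) (d a : Fin n) : Set where
  field
    {d′ a′}  : Fin n
    d≤d′     : d ≤ d′
    a′≤a     : a′ ≤ a
    pos-d≤d′ : pos w d ≤ pos w d′
    pos-a′≤a : pos w a′ ≤ pos w a
    adjacent : Adjacent w d′ a′

crossing-entries : ∀ (w : Permutation′ n) {P : Pred (Fin n) 0ℓ} → Decidable P → ∀ {u v} → Before w u v →
                   P u → ¬ P v →
                   ∃[ p ] ∃[ q ] Adjacent w p q × pos w u ≤ pos w p × pos w q ≤ pos w v × P p × ¬ P q
crossing-entries w {P} P? {u} {v} uv Pu ¬Pv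
  with i , j , i⋖j , u≤i , j≤v , Pi , ¬Pj ←
    crossing (P? ∘ (w ⟨$⟩ʳ_)) uv (subst P (sym (inverseʳ w)) Pu) (¬Pv ∘ subst P (inverseʳ w))
  = w ⟨$⟩ʳ i , w ⟨$⟩ʳ j , subst₂ _⋖ₚ_ (sym (inverseˡ w)) (sym (inverseˡ w)) i⋖j ,
    subst (pos w u ≤_) (sym (inverseˡ w)) u≤i , subst (_≤ pos w v) (sym (inverseˡ w)) j≤v , Pi , ¬Pj

-- On the way from `d` to `a` the entries fall below `d` at some descent `p q` with `q < d ≤ p`. If
-- `a < q`, then `q` would split the inversion, being placed after `d` and not after `a`; so
-- `q ≤ a`.
straddle : ∀ (w : Permutation′ n) {a d} → a < d → Before w d a → Unsplit w d a → Straddle w d a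
straddle w {a} {d} a<d da unsplit
  with p , q , adj , d≤p , q≤a , d≤p′ , d≰q ← crossing-entries w (d ≤?_) da ℕ.≤-refl (ℕ.<⇒≱ a<d)
  = record
    { d≤d′ = d≤p′
    ; a′≤a = ℕ.≮⇒≥ λ a<q → [ ℕ.<⇒≯ (ℕ.≤-<-trans d≤p (⋖ₚ⇒< adj)) , ℕ.≤⇒≯ q≤a ]′ (unsplit q a<q (ℕ.≰⇒> d≰q))
    ; pos-d≤d′ = d≤p
    ; pos-a′≤a = q≤a
    ; adjacent = adj
    }

⊑-pos : x ⊑ w → u ≤ v → pos w u ≤ pos w v → pos x u ≤ pos x v
⊑-pos {x = x} {w = w} {u = u} {v} x⊑w u≤v uv with u ≟ v
... | yes refl = ℕ.≤-refl
... | no u≢v = ℕ.<⇒≤ (⊑-noninversion {x = x} {y = w} x⊑w (≤∧≢⇒< u≤v u≢v) (≤∧≢⇒< uv (u≢v ∘ pos-injective w)))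

-- Let `d′ a′` be the descent straddled by an unsplit inversion `(a , d)` of `w`. The pairs `d`,
-- `d′` and `a′`, `a` are in increasing order in `w`, hence also in any `x ⊑ w`; so if `x` has `d′`
-- before `a′`, it has `d` before `a`.
⊑-by-descents : (∀ a d → a < d → Adjacent w d a → ∃[ x ] x ⊑ w × x ⊑ y × Before x d a) → w ⊑ y
⊑-by-descents {w = w} {y = y} below =
  unsplit-generate w (flip ℕ.<-trans) base
  where
  base : ∀ a d → a < d → Before w d a → Unsplit w d a → Before y d a
  base a d a<d da unsplit =
    let open Straddle (straddle w a<d da unsplit)
        x , x⊑w , x⊑y , d′a′ = below a′ d′ (ℕ.≤-<-trans a′≤a (ℕ.<-≤-trans a<d d≤d′)) adjacent
    in x⊑y a d a<d (ℕ.≤-<-trans (⊑-pos {x = x} {w = w} x⊑w d≤d′ pos-d≤d′)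
                     (ℕ.<-≤-trans d′a′ (⊑-pos {x = x} {w = w} x⊑w a′≤a pos-a′≤a)))

-- Removing only inversions that x and y both lack, a descent from any upper bound
-- of x and y ends at their join.
module Above (x y : Permutation′ n) where

  S : Permutation′ n → Rel (Fin n) 0ℓ
  S _ a d = ¬ Before x d a × ¬ Before y d a

  open Descent S (λ _ a d → ¬? (Before? x d a) ×-dec ¬? (Before? y d a)) public

  step-above : ∀ {w w′} → Step w w′ → x ⊑ w × y ⊑ w → x ⊑ w′ × y ⊑ w′
  step-above {w} {w′} (a , d , drop , ¬x , ¬y) (x⊑w , y⊑w) = above x x⊑w ¬x , above y y⊑w ¬y
    where
    above : ∀ z → z ⊑ w → ¬ Before z d a → z ⊑ w′
    above z z⊑w ¬da b c b<c cb with Drops.keep drop c b (z⊑w b c b<c cb)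
    ... | inj₁ (refl , refl) = contradiction cb ¬da
    ... | inj₂ cb′ = cb′

  steps-above : ∀ {w w′} → Star Step w w′ → x ⊑ w × y ⊑ w → x ⊑ w′ × y ⊑ w′
  steps-above ε = id
  steps-above (step ◅ steps) = steps-above steps ∘ step-above step

  terminal-descents : ∀ {w} → Terminal w → ∀ a d → a < d → Adjacent w d a → Before x d a ⊎ Before y d a
  terminal-descents terminal a d a<d da with Before? x d a | Before? y d a
  ... | yes xda | _ = inj₁ xda
  ... | _ | yes yda = inj₂ yda
  ... | no ¬x | no ¬y = contradiction (¬x , ¬y) (terminal a d a<d da)

  terminal-least : ∀ {w} → Terminal w → x ⊑ w × y ⊑ w → x ⊑ z → y ⊑ z → w ⊑ z
  terminal-least {z} {w} terminal (x⊑w , y⊑w) x⊑z y⊑z = ⊑-by-descents {w = w} {y = z} below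
    where
    below : ∀ a d → a < d → Adjacent w d a → ∃[ x ] x ⊑ w × x ⊑ z × Before x d a
    below a d a<d da with terminal-descents {w} terminal a d a<d da
    ... | inj₁ xda = x , x⊑w , x⊑z , xda
    ... | inj₂ yda = y , y⊑w , y⊑z , yda

-- With both arguments of `Above` equal to `x`, the descent from `y` ends at the join of `x` with
-- itself, which is `x`. Its steps are covers of the weak order.
⊑⇒≤ʷ : x ⊑ y → x ≤ʷ y
⊑⇒≤ʷ {x = x} {y = y} x⊑y =
  let open Above x x
      w , steps , terminal = descend y
      above = steps-above steps (x⊑y , x⊑y)
      x⊑x = ⊑-reflexive {x = x} {x} λ _ → refl
      w⊑x = terminal-least {z = x} {w} terminal above x⊑x x⊑x
  in inj₁ (⊑-antisym {x = x} {y = w} (proj₁ above) w⊑x) ◅ steps⇒≤ʷ steps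

⋖⇒drops : x ⋖ y → ∃[ a ] ∃[ d ] Drops y x a d
⋖⇒drops {x = x} {y = y} (i , j , i⋖j , xi<xj , y≈) =
  x ⟨$⟩ʳ i , x ⟨$⟩ʳ j ,
  swap-drops {y = y} {x = x} xi<xj (subst₂ _⋖ₚ_ (sym pos-xj) (sym pos-xi) i⋖j) λ k →
    sym (trans (cong₂ (λ p q → y ⟨$⟩ʳ PC.transpose p q k) pos-xj pos-xi)
      (trans (y≈ (PC.transpose i j k)) (cong (x ⟨$⟩ʳ_) (transpose-involutive i j k))))
  where
  pos-xj : pos y (x ⟨$⟩ʳ j) ≡ i
  pos-xj = trans (cong (pos y) (sym (trans (y≈ i) (cong (x ⟨$⟩ʳ_) (transposeˡ i j))))) (inverseˡ y)
  pos-xi : pos y (x ⟨$⟩ʳ i) ≡ j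
  pos-xi = trans (cong (pos y) (sym (trans (y≈ j) (cong (x ⟨$⟩ʳ_) (transposeʳ i j))))) (inverseˡ y)

≤ʷ⇒⊑ : x ≤ʷ y → x ⊑ y
≤ʷ⇒⊑ {x = x} ε = ⊑-reflexive {x = x} {x} λ _ → refl
≤ʷ⇒⊑ {x = x} {y = y} (_◅_ {j = w} step x≤y) = ⊑-trans {x = x} {w} {y} (first step) (≤ʷ⇒⊑ x≤y)
  where
  first : x ≈ w ⊎ x ⋖ w → x ⊑ w
  first (inj₁ x≈w) = ⊑-reflexive {x = x} {w} x≈w
  first (inj₂ x⋖w) = Drops.drop⇒⊑ (proj₂ (proj₂ (⋖⇒drops {x = x} {w} x⋖w)))

-- Patterns at descents

-- At a descent `d a`, the choice `_>_` for `Q` gives the pattern 3-41-2 and `_<_` gives 2-41-3.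
-- Adjacency is left out so that the notion also applies to unsplit inversions.
record Occurs (Q : Rel (Fin n) 0ℓ) (w : Permutation′ n) (a d : Fin n) : Set where
  constructor occurrence
  field
    {l r} : Fin n
    a<l   : a < l
    l<d   : l < d
    a<r   : a < r
    r<d   : r < d
    l-d   : Before w l d
    a-r   : Before w a r
    Qlr   : Q l r

AvoidsAtDescents : Rel (Fin n) 0ℓ → Pred (Permutation′ n) 0ℓ
AvoidsAtDescents Q w = ∀ a d → a < d → Adjacent w d a → ¬ Occurs Q w a d

-- The straddled descent encloses `(a , d)` both in value and in position, so the same `l` and `r`
-- form an occurrence around it.
avoids-unsplit : ∀ {Q : Rel (Fin n) 0ℓ} {a d} → AvoidsAtDescents Q w →
                 a < d → Before w d a → Unsplit w d a → ¬ Occurs Q w a d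
avoids-unsplit {w = w} avoids a<d da unsplit (occurrence a<l l<d a<r r<d l-d a-r Qlr) =
  let open Straddle (straddle w a<d da unsplit) in
  avoids _ _ (ℕ.≤-<-trans a′≤a (ℕ.<-≤-trans a<d d≤d′)) adjacent
    (occurrence (ℕ.≤-<-trans a′≤a a<l) (ℕ.<-≤-trans l<d d≤d′) (ℕ.≤-<-trans a′≤a a<r) (ℕ.<-≤-trans r<d d≤d′)
                (ℕ.<-≤-trans l-d pos-d≤d′) (ℕ.≤-<-trans pos-a′≤a a-r) Qlr)

avoids-resp-≈ : ∀ {Q : Rel (Fin n) 0ℓ} → x ≈ y → AvoidsAtDescents Q x → AvoidsAtDescents Q y
avoids-resp-≈ {x = x} {y = y} x≈y avoids a d a<d da (occurrence a<l l<d a<r r<d l-d a-r Qlr) =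
  avoids a d a<d (subst₂ _⋖ₚ_ pos≡ pos≡ da)
    (occurrence a<l l<d a<r r<d (subst₂ _<_ pos≡ pos≡ l-d) (subst₂ _<_ pos≡ pos≡ a-r) Qlr)
  where
  pos≡ : ∀ {u} → pos y u ≡ pos x u
  pos≡ = sym (pos-cong {x = x} {y} x≈y)

-- Intended meaning of D w a d: w lies above some join-irreducible permutation
-- whose only descent is d a and in which that descent is free of Q.
record Detector {n} (Q : Rel (Fin n) 0ℓ) : Set₁ where
  field
    Q?       : ∀ l r → Dec (Q l r)
    D        : Permutation′ n → Rel (Fin n) 0ℓ
    before   : D w u v → Before w v u
    mono     : x ⊑ y → u < v → D x u v → D y u v
    sound    : u < v → D w u v → ¬ Occurs Q w u v
    complete : u < v → Before w v u → Unsplit w v u → ¬ Occurs Q w u v → D w u v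
    stable   : ∀ {a d} → Drops y x a d → Occurs Q y a d → u < v → D y u v → D x u v

  occurs? : ∀ w a d → Dec (Occurs Q w a d)
  occurs? w a d
    with any? (λ l → any? (λ r → (a <? l ×-dec l <? d) ×-dec (a <? r ×-dec r <? d) ×-dec
                                 Before? w l d ×-dec Before? w a r ×-dec Q? l r))
  ... | yes (_ , _ , (a<l , l<d) , (a<r , r<d) , l-d , a-r , Qlr) =
    yes (occurrence a<l l<d a<r r<d l-d a-r Qlr)
  ... | no none =
    no λ { (occurrence a<l l<d a<r r<d l-d a-r Qlr) →
             none (_ , _ , (a<l , l<d) , (a<r , r<d) , l-d , a-r , Qlr) }

  open Descent (Occurs Q) occurs? public

  infix 4 _⊆ᴰ_
  _⊆ᴰ_ : Rel (Permutation′ n) 0ℓ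
  x ⊆ᴰ y = ∀ a d → a < d → D x a d → D y a d

  π : Permutation′ n → Permutation′ n
  π = proj₁ ∘ descend

  steps : ∀ y → Star Step y (π y)
  steps = proj₁ ∘ proj₂ ∘ descend

  π-avoids : ∀ y → AvoidsAtDescents Q (π y)
  π-avoids = proj₂ ∘ proj₂ ∘ descend

  least : AvoidsAtDescents Q z → z ⊆ᴰ y → z ⊑ y
  least {z = z} {y = y} avoids z⊆y =
    unsplit-generate z (flip ℕ.<-trans) λ a d a<d da unsplit →
      before {w = y} (z⊆y a d a<d
        (complete {w = z} a<d da unsplit (avoids-unsplit {w = z} avoids a<d da unsplit)))

  -- An entry splitting d a in z would also lie between d and a in w.
  join-avoids : AvoidsAtDescents Q z → z ⊑ w → ∀ {a d} → a < d → Adjacent w d a → Before z d a → ¬ Occurs Q w a d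
  join-avoids {z = z} {w = w} avoids z⊑w {a} {d} a<d adj da =
    sound {w = w} a<d (mono {x = z} {y = w} z⊑w a<d
      (complete {w = z} a<d da unsplit (avoids-unsplit {w = z} avoids a<d da unsplit)))
    where
    unsplit : Unsplit z d a
    unsplit g a<g g<d with Before? z d g
    ... | no ¬dg = inj₁ (¬before⇒after z (<⇒≢′ g<d) ¬dg)
    ... | yes dg = inj₂ (¬before⇒after z (<⇒≢′ a<g) λ ga →
            ℕ.<⇒≱ (z⊑w a g a<g ga) (⋖ₚ<⇒≤ adj (z⊑w g d g<d dg)))

-- The detectors for 3-41-2 and 2-41-3

confined : Detector {n} _>_
confined {n} = record
  { Q? = flip _<?_
  ; D = D
  ; before = λ {w = w} → before {w}
  ; mono = λ {x = x} {y = y} → mono {x = x} {y}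
  ; sound = λ {w = w} → sound {w = w}
  ; complete = λ {w = w} → complete {w = w}
  ; stable = λ {y = y} {x = x} → stable {y = y} {x}
  }
  where
  -- Without 3-41-2, the values left of the descent are smaller than those right of it. The
  -- condition amounts to a cut of the values between `a` and `d`: those below it precede `a`, those
  -- from it on follow `d`. The least value not preceding `a` serves as the cut.
  D : Permutation′ n → Rel (Fin n) 0ℓ
  D w a d = Before w d a × (∀ b c → a < b → b ≤ c → c < d → Before w b a ⊎ Before w d c)

  before : D w u v → Before w v u
  before = proj₁

  mono : x ⊑ y → u < v → D x u v → D y u v
  mono x⊑y u<v (vu , split) = x⊑y _ _ u<v vu , λ b c u<b b≤c c<v →
    Sum.map (x⊑y _ _ u<b) (x⊑y _ _ c<v) (split b c u<b b≤c c<v)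

  sound : u < v → D w u v → ¬ Occurs _>_ w u v
  sound u<v (_ , split) (occurrence a<l l<d a<r r<d l-d a-r r<l) =
    [ ℕ.<-asym a-r , ℕ.<-asym l-d ]′ (split _ _ a<r (ℕ.<⇒≤ r<l) l<d)

  complete : u < v → Before w v u → Unsplit w v u → ¬ Occurs _>_ w u v → D w u v
  complete {u} {v} {w} u<v vu unsplit free = vu , split
    where
    split : ∀ b c → u < b → b ≤ c → c < v → Before w b u ⊎ Before w v c
    split b c u<b b≤c c<v with unsplit b u<b (ℕ.≤-<-trans b≤c c<v) | unsplit c (ℕ.<-≤-trans u<b b≤c) c<v
    ... | inj₁ bv | _ = inj₁ (ℕ.<-trans bv vu)
    ... | _ | inj₂ uc = inj₂ (ℕ.<-trans vu uc)
    ... | inj₂ ub | inj₁ cv = contradiction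
      (occurrence (ℕ.<-≤-trans u<b b≤c) c<v u<b (ℕ.≤-<-trans b≤c c<v) cv ub
        (≤∧≢⇒< b≤c λ { refl → ℕ.<-asym vu (ℕ.<-trans ub cv) }))
      free

  -- If the dropped inversion is the one that served for `b`, then `b = d` and `u = a`. The
  -- condition in `y` for `r` and `c` leaves only `c` after `v`, since `r` follows `a`. Dually, if
  -- it served for `c`, then `l` takes the place of `c`.
  stable : ∀ {a d} → Drops y x a d → Occurs _>_ y a d → u < v → D y u v → D x u v
  stable {y} {x} {u} {v} {a} {d} drop occ@(occurrence {l} {r} a<l l<d a<r r<d l-d a-r r<l) u<v (vu , split) =
    vu′ , split′
    where
    open Drops drop

    vu′ : Before x v u
    vu′ with keep v u vu
    ... | inj₁ (refl , refl) = contradiction occ (sound {w = y} u<v (vu , split))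
    ... | inj₂ vu′ = vu′

    split′ : ∀ b c → u < b → b ≤ c → c < v → Before x b u ⊎ Before x v c
    split′ b c u<b b≤c c<v with split b c u<b b≤c c<v
    split′ b c u<b b≤c c<v | inj₁ bu with keep b u bu
    ... | inj₂ bu′ = inj₁ bu′
    ... | inj₁ (refl , refl) with split r c a<r (ℕ.≤-trans (ℕ.<⇒≤ r<d) b≤c) c<v
    ...   | inj₁ ra = contradiction ra (ℕ.<-asym a-r)
    ...   | inj₂ vc with keep v c vc
    ...     | inj₁ (_ , refl) = contradiction u<b (ℕ.≤⇒≯ b≤c)
    ...     | inj₂ vc′ = inj₂ vc′
    split′ b c u<b b≤c c<v | inj₂ vc with keep v c vc
    ... | inj₂ vc′ = inj₂ vc′
    ... | inj₁ (refl , refl) with split b l u<b (ℕ.<⇒≤ (ℕ.≤-<-trans b≤c a<l)) l<d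
    ...   | inj₂ dl = contradiction dl (ℕ.<-asym l-d)
    ...   | inj₁ bu with keep b u bu
    ...     | inj₁ (_ , refl) = contradiction u<b (ℕ.≤⇒≯ b≤c)
    ...     | inj₂ bu′ = inj₁ bu′

separated : Detector {n} _<_
separated {n} = record
  { Q? = _<?_
  ; D = D
  ; before = λ {w = w} → before {w = w}
  ; mono = λ {x = x} {y = y} → mono {x = x} {y}
  ; sound = λ {w = w} → sound {w = w}
  ; complete = λ {w = w} → complete {w = w}
  ; stable = λ {y = y} {x = x} → stable {y = y} {x}
  }
  where
  -- Without 2-41-3, the values left of the descent are larger than those right of it. With the cut
  -- at `m`, every value from `m` to `d` then precedes every value from `a` up to, but excluding,
  -- `m`.
  D : Permutation′ n → Rel (Fin n) 0ℓ
  D w a d = ∃[ m ] a < m × m ≤ d × (∀ p q → a ≤ p → p < m → m ≤ q → q ≤ d → Before w q p)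

  before : D w u v → Before w v u
  before (m , u<m , m≤v , inv) = inv _ _ ℕ.≤-refl u<m m≤v ℕ.≤-refl

  mono : x ⊑ y → u < v → D x u v → D y u v
  mono x⊑y u<v (m , u<m , m≤v , inv) = m , u<m , m≤v , λ p q u≤p p<m m≤q q≤v →
    x⊑y p q (ℕ.<-≤-trans p<m m≤q) (inv p q u≤p p<m m≤q q≤v)

  sound : u < v → D w u v → ¬ Occurs _<_ w u v
  sound u<v (m , u<m , m≤v , inv) (occurrence {l} {r} a<l l<d a<r r<d l-d a-r l<r) with r <? m
  ... | yes r<m = ℕ.<-asym l-d (inv _ _ (ℕ.<⇒≤ a<l) (ℕ.<-trans l<r r<m) m≤v ℕ.≤-refl)
  ... | no r≮m  = ℕ.<-asym a-r (inv _ _ ℕ.≤-refl u<m (ℕ.≮⇒≥ r≮m) (ℕ.<⇒≤ r<d))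

  -- Going up the values from `u`, which is right of `v`, to `v` itself, some consecutive `m′`, `m`
  -- pass from right of `v` to not right of it. A `q` above `m` lying right of `v` would form an
  -- occurrence with `m`; a `p` below `m′` lying left of `u` would form one with `m′`.
  complete : u < v → Before w v u → Unsplit w v u → ¬ Occurs _<_ w u v → D w u v
  complete {u} {v} {w} u<v vu unsplit free
    with m′ , m , m′⋖m , u≤m′ , m≤v , ¬m′≤v , ¬¬m≤v ←
      crossing (λ t → ¬? (pos w t ≤? pos w v)) u<v (ℕ.<⇒≱ vu) (λ v≰v → v≰v ℕ.≤-refl)
    = m , u<m m′⋖m u≤m′ , m≤v , λ p q u≤p p<m m≤q q≤v →
      ℕ.≤-<-trans (left m′⋖m u≤m′ ¬¬m≤v q m≤q q≤v)
                  (ℕ.<-≤-trans vu (right m′⋖m m≤v ¬m′≤v p u≤p p<m))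
    where
    u<m : ∀ {m m′} → m′ ⋖ₚ m → u ≤ m′ → u < m
    u<m m′⋖m u≤m′ = ℕ.≤-<-trans u≤m′ (⋖ₚ⇒< m′⋖m)

    left : ∀ {m m′} → m′ ⋖ₚ m → u ≤ m′ → ¬ ¬ pos w m ≤ pos w v →
           ∀ q → m ≤ q → q ≤ v → pos w q ≤ pos w v
    left {m} {m′} m′⋖m u≤m′ ¬¬m≤v q m≤q q≤v with pos w q ≤? pos w v
    ... | yes q-left = q-left
    ... | no q-right = contradiction q-left q-right
      where
      q<v : q < v
      q<v = ≤∧≢⇒< q≤v λ { refl → q-right ℕ.≤-refl }
      m<q : m < q
      m<q = ≤∧≢⇒< m≤q λ { refl → ¬¬m≤v q-right }
      m-v : Before w m v
      m-v = ¬before⇒after w (<⇒≢′ (ℕ.<-trans m<q q<v)) (¬¬m≤v ∘ ℕ.<⇒≱)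
      q-left : pos w q ≤ pos w v
      q-left with unsplit q (ℕ.<-trans (u<m m′⋖m u≤m′) m<q) q<v
      ... | inj₁ qv = ℕ.<⇒≤ qv
      ... | inj₂ uq = contradiction
        (occurrence (u<m m′⋖m u≤m′) (ℕ.<-trans m<q q<v) (ℕ.<-trans (u<m m′⋖m u≤m′) m<q) q<v m-v uq m<q) free

    right : ∀ {m m′} → m′ ⋖ₚ m → m ≤ v → ¬ pos w m′ ≤ pos w v →
            ∀ p → u ≤ p → p < m → pos w u ≤ pos w p
    right {m} {m′} m′⋖m m≤v ¬m′≤v p u≤p p<m = ℕ.≮⇒≥ impossible
      where
      m′<v : m′ < v
      m′<v = ℕ.<-≤-trans (⋖ₚ⇒< m′⋖m) m≤v
      impossible : ¬ Before w p u
      impossible pu = contradiction (occurrence u<p (ℕ.<-≤-trans p<m m≤v) u<m′ m′<v p-v u-m′ p<m′) free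
        where
        u<p : u < p
        u<p = ≤∧≢⇒< u≤p λ { refl → ℕ.<-irrefl refl pu }
        p-v : Before w p v
        p-v with unsplit p u<p (ℕ.<-≤-trans p<m m≤v)
        ... | inj₁ pv = pv
        ... | inj₂ up = contradiction pu (ℕ.<-asym up)
        p<m′ : p < m′
        p<m′ = ≤∧≢⇒< (<⋖ₚ⇒≤ m′⋖m p<m) λ { refl → ¬m′≤v (ℕ.<⇒≤ p-v) }
        u<m′ : u < m′
        u<m′ = ℕ.<-trans u<p p<m′
        u-m′ : Before w u m′
        u-m′ with unsplit m′ u<m′ m′<v
        ... | inj₁ m′v = contradiction (ℕ.<⇒≤ m′v) ¬m′≤v
        ... | inj₂ um′ = um′

  -- The cut `m` is kept, since the dropped pair never lies across it: if `r < m`, the condition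
  -- would place `d` before `l`, and otherwise it would place `r` before `a`.
  stable : ∀ {a d} → Drops y x a d → Occurs _<_ y a d → u < v → D y u v → D x u v
  stable {y} {x} {u} {v} {a} {d} drop (occurrence {l} {r} a<l l<d a<r r<d l-d a-r l<r) u<v (m , u<m , m≤v , inv) =
    m , u<m , m≤v , inv′
    where
    open Drops drop

    inv′ : ∀ p q → u ≤ p → p < m → m ≤ q → q ≤ v → Before x q p
    inv′ p q u≤p p<m m≤q q≤v with keep q p (inv p q u≤p p<m m≤q q≤v)
    ... | inj₂ qp = qp
    ... | inj₁ (refl , refl) with r <? m
    ...   | yes r<m = contradiction (inv l d (ℕ.≤-trans u≤p (ℕ.<⇒≤ a<l)) (ℕ.<-trans l<r r<m) m≤q q≤v) (ℕ.<-asym l-d)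
    ...   | no r≮m  = contradiction (inv a r u≤p p<m (ℕ.≮⇒≥ r≮m) (ℕ.<⇒≤ (ℕ.<-≤-trans r<d q≤v))) (ℕ.<-asym a-r)

module C {n} = Detector (confined {n})
module S {n} = Detector (separated {n})

-- Reversal of the one-line notation

rev : Permutation′ n → Permutation′ n
rev x = reverse ∘ₚ x

rev-involutive : ∀ (x : Permutation′ n) → rev (rev x) ≈ x
rev-involutive x i = cong (x ⟨$⟩ʳ_) (opposite-involutive i)

rev-cong : x ≈ y → rev x ≈ rev y
rev-cong x≈y i = x≈y (opposite i)

opposite-anti : ∀ {i j : Fin n} → i < j → opposite j < opposite i
opposite-anti {i = i} {j} i<j =
  subst₂ ℕ._<_ (sym (opposite-prop j)) (sym (opposite-prop i)) (ℕ.∸-monoʳ-< (ℕ.s≤s i<j) (toℕ<n j))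

opposite-⋖ₚ : ∀ {i j : Fin n} → i ⋖ₚ j → opposite j ⋖ₚ opposite i
opposite-⋖ₚ {n} {i} {j} i⋖j =
  trans (opposite-prop i)
    (trans (cong (n ℕ.∸_) (sym i⋖j))
      (trans (ℕ.+-∸-assoc 1 (toℕ<n j)) (cong ℕ.suc (sym (opposite-prop j)))))

before-rev : ∀ (x : Permutation′ n) → Before x u v → Before (rev x) v u
before-rev x = opposite-anti

before-unrev : ∀ (x : Permutation′ n) → Before (rev x) u v → Before x v u
before-unrev x uv = subst₂ _<_ (opposite-involutive _) (opposite-involutive _) (opposite-anti uv)

rev-anti : x ⊑ y → rev y ⊑ rev x
rev-anti {x = x} {y = y} x⊑y a d a<d =
  before-rev x ∘ ⊑-noninversion {x = x} {y = y} x⊑y a<d ∘ before-unrev y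

rev-cancel : rev x ⊑ rev y → y ⊑ x
rev-cancel {x = x} {y = y} x⊑y a d a<d =
  before-unrev x ∘ ⊑-noninversion {x = rev x} {y = rev y} x⊑y a<d ∘ before-rev y

drops-adjacent : ∀ {a d} → Drops y x a d → Adjacent x a d
drops-adjacent {y = y} {x = x} {a} {d} drop = 
  subst₂ _⋖ₚ_ (sym (pos≡ (transposeˡ j i))) (sym (pos≡ (transposeʳ j i))) adjacent
  where
  open Drops drop
  i = pos y d
  j = pos y a
  pos≡ : ∀ {u k} → PC.transpose j i (pos y u) ≡ k → pos x u ≡ k
  pos≡ = trans (pos-cong {x = x} {swapEntries i j y} (drops-swap {y = y} {x} drop))

rev-drops : ∀ {a d} → Drops y x a d → Drops (rev x) (rev y) a d
rev-drops {y = y} {x = x} drop = record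
  { a<d = a<d
  ; adjacent = opposite-⋖ₚ (drops-adjacent {y = y} {x = x} drop)
  ; keep = λ u v → Sum.map swap (before-rev y) ∘ restore v u ∘ before-unrev x
  ; new = before-rev y (⋖ₚ⇒< adjacent)
  }
  where open Drops drop

-- Only `d` and `a` change places, so `l` still precedes and `r` still follows both of them in `x`.
-- Reversal exchanges the roles of `l` and `r`, which turns 3-41-2 into 2-41-3.
rev-occurs : ∀ {Q : Rel (Fin n) 0ℓ} {a d} → Drops y x a d → Occurs Q y a d → Occurs (flip Q) (rev x) a d
rev-occurs {y = y} {x = x} {a = a} {d} drop (occurrence {l} {r} a<l l<d a<r r<d l-d a-r Qlr) =
  occurrence a<r r<d a<l l<d (before-rev x d-r) (before-rev x l-a) Qlr
  where
  open Drops drop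
  d-r : Before x d r
  d-r with keep d r (ℕ.<-trans (⋖ₚ⇒< adjacent) a-r)
  ... | inj₁ (_ , refl) = contradiction a<r (ℕ.<-irrefl refl)
  ... | inj₂ dr = dr
  l-a : Before x l a
  l-a with keep l a (ℕ.<-trans l-d (⋖ₚ⇒< adjacent))
  ... | inj₁ (refl , _) = contradiction l<d (ℕ.<-irrefl refl)
  ... | inj₂ la = la

-- Positions of pattern entries versus their values

module _ (w : Permutation′ n) where

  lower : ∀ {i j} → i < j → Before w (w ⟨$⟩ʳ i) (w ⟨$⟩ʳ j)
  lower = subst₂ _<_ (sym (inverseˡ w)) (sym (inverseˡ w))

  adjacent-values : ∀ {i j} → i ⋖ₚ j → Adjacent w (w ⟨$⟩ʳ i) (w ⟨$⟩ʳ j)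
  adjacent-values = subst₂ _⋖ₚ_ (sym (inverseˡ w)) (sym (inverseˡ w))

  entries : u < v → w ⟨$⟩ʳ (pos w u) < w ⟨$⟩ʳ (pos w v)
  entries = subst₂ _<_ (sym (inverseʳ w)) (sym (inverseʳ w))

  Is3-41-2⇒occurs : ∀ {i j k l} → Is3-41-2 w i j k l → Occurs _>_ w (w ⟨$⟩ʳ k) (w ⟨$⟩ʳ j)
  Is3-41-2⇒occurs (i<j , j⋖k , k<l , a<b , b<c , c<d) =
    occurrence (ℕ.<-trans a<b b<c) c<d a<b (ℕ.<-trans b<c c<d) (lower i<j) (lower k<l) b<c

  occurs⇒Is3-41-2 : ∀ {a d} → Adjacent w d a → Occurs _>_ w a d →
                    ∃[ i ] ∃[ l ] Is3-41-2 w i (pos w d) (pos w a) l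
  occurs⇒Is3-41-2 da (occurrence a<l l<d a<r r<d l-d a-r r<l) =
    _ , _ , l-d , da , a-r , entries a<r , entries r<l , entries l<d

  avoids-3-41-2⁺ : AvoidsAtDescents _>_ w → Avoids Is3-41-2 w
  avoids-3-41-2⁺ avoids (i , j , k , l , p@(i<j , j⋖k , k<l , a<b , b<c , c<d)) =
    avoids _ _ (ℕ.<-trans a<b (ℕ.<-trans b<c c<d)) (adjacent-values j⋖k) (Is3-41-2⇒occurs p)

  avoids-3-41-2⁻ : Avoids Is3-41-2 w → AvoidsAtDescents _>_ w
  avoids-3-41-2⁻ avoids a d a<d da occ with i , l , p ← occurs⇒Is3-41-2 da occ =
    avoids (i , _ , _ , l , p)

  avoids-2-41-3⁺ : AvoidsAtDescents _<_ w → Avoids Is2-41-3 w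
  avoids-2-41-3⁺ avoids (i , j , k , l , i<j , j⋖k , k<l , a<b , b<c , c<d) =
    avoids _ _ (ℕ.<-trans a<b (ℕ.<-trans b<c c<d)) (adjacent-values j⋖k)
      (occurrence a<b (ℕ.<-trans b<c c<d) (ℕ.<-trans a<b b<c) c<d (lower i<j) (lower k<l) b<c)

  avoids-2-41-3⁻ : Avoids Is2-41-3 w → AvoidsAtDescents _<_ w
  avoids-2-41-3⁻ avoids a d a<d da (occurrence a<l l<d a<r r<d l-d a-r l<r) =
    avoids (_ , _ , _ , _ , l-d , da , a-r , entries a<l , entries l<r , entries r<d)

avoids-3-14-2⁺ : ∀ (w : Permutation′ n) → AvoidsAtDescents _<_ (rev w) → Avoids Is3-14-2 w
avoids-3-14-2⁺ w avoids (i , j , k , l , i<j , j⋖k , k<l , a<b , b<c , c<d) =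
  avoids _ _ (ℕ.<-trans a<b (ℕ.<-trans b<c c<d)) (opposite-⋖ₚ (adjacent-values w j⋖k))
    (occurrence a<b (ℕ.<-trans b<c c<d) (ℕ.<-trans a<b b<c) c<d
      (before-rev w (lower w k<l)) (before-rev w (lower w i<j)) b<c)

avoids-3-14-2⁻ : ∀ (w : Permutation′ n) → Avoids Is3-14-2 w → AvoidsAtDescents _<_ (rev w)
avoids-3-14-2⁻ w avoids a d a<d da (occurrence a<l l<d a<r r<d l-d a-r l<r) =
  avoids (_ , _ , _ , _ , before-unrev w a-r ,
    subst₂ _⋖ₚ_ (opposite-involutive _) (opposite-involutive _) (opposite-⋖ₚ da) , before-unrev w l-d ,
    entries w a<l , entries w l<r , entries w r<d)

⟶⇒drops : y ⟶ x → ∃[ a ] ∃[ d ] Drops y x a d × Occurs _>_ y a d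
⟶⇒drops {y = y} {x = x} (i , j , k , l , p@(i<j , j⋖k , k<l , a<b , b<c , c<d) , x≈) =
  y ⟨$⟩ʳ k , y ⟨$⟩ʳ j ,
  swap-drops {y = y} {x = x} (ℕ.<-trans a<b (ℕ.<-trans b<c c<d)) (adjacent-values y j⋖k)
    (λ t → trans (x≈ t) (cong₂ (λ p q → y ⟨$⟩ʳ PC.transpose p q t) (sym (inverseˡ y)) (sym (inverseˡ y)))) ,
  Is3-41-2⇒occurs y p

drops⇒⟶ : ∀ {a d} → Drops y x a d → Occurs _>_ y a d → y ⟶ x
drops⇒⟶ {y = y} {x = x} drop occ with i , l , p ← occurs⇒Is3-41-2 y (Drops.adjacent drop) occ =
  i , _ , _ , l , p , drops-swap {y = y} {x = x} drop

-- The congruence Θ₃₄₁₂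

infix 4 _⊆Θ_
-- The first component serves to recognise the bottom of a class, the second its top. Along a move,
-- one of them is preserved by monotonicity and the other by stability; against the move, the two
-- reasons are exchanged. Since `_≡Θ_` is symmetric, both conditions are constant on classes.
_⊆Θ_ : Rel (Permutation′ n) 0ℓ
y ⊆Θ x = y C.⊆ᴰ x × rev y S.⊆ᴰ rev x

≈⇒⊆Θ : y ≈ x → y ⊆Θ x
≈⇒⊆Θ {y = y} {x = x} y≈x =
  (λ a d → C.mono {x = y} {y = x} (⊑-reflexive {x = y} {x} y≈x)) ,
  (λ a d → S.mono {x = rev y} {y = rev x} (⊑-reflexive {x = rev y} {rev x} (rev-cong {x = y} {x} y≈x)))

⟶⇒⊆Θ : y ⟶ x → y ⊆Θ x
⟶⇒⊆Θ {y = y} {x = x} move =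
  let a , d , drop , occ = ⟶⇒drops {y = y} {x} move in
  (λ _ _ → C.stable {y = y} {x = x} drop occ) ,
  (λ _ _ → S.mono {x = rev y} {y = rev x} (rev-anti {x = x} {y} (Drops.drop⇒⊑ drop)))

⟵⇒⊆Θ : y ⟶ x → x ⊆Θ y
⟵⇒⊆Θ {y = y} {x = x} move =
  let a , d , drop , occ = ⟶⇒drops {y = y} {x} move in
  (λ _ _ → C.mono {x = x} {y = y} (Drops.drop⇒⊑ drop)) ,
  (λ _ _ → S.stable {y = rev x} {x = rev y} (rev-drops {y = y} {x} drop) (rev-occurs {y = y} {x} drop occ))

Θ⇒⊆Θ : y ≡Θ x → y ⊆Θ x
Θ⇒⊆Θ ε = (λ _ _ _ → id) , (λ _ _ _ → id)
Θ⇒⊆Θ {y = y} {x = x} (_◅_ {j = z} step rest) =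
  let c , s = first step
      c′ , s′ = Θ⇒⊆Θ rest
  in (λ a d a<d → c′ a d a<d ∘ c a d a<d) , (λ a d a<d → s′ a d a<d ∘ s a d a<d)
  where
  first : SymClosure _ y z → y ⊆Θ z
  first (fwd (inj₁ y≈z)) = ≈⇒⊆Θ {y = y} {z} y≈z
  first (bwd (inj₁ z≈y)) = ≈⇒⊆Θ {y = y} {z} (sym ∘ z≈y)
  first (fwd (inj₂ move)) = ⟶⇒⊆Θ {y = y} {z} move
  first (bwd (inj₂ move)) = ⟵⇒⊆Θ {y = z} {y} move

π↓ π↑ : Permutation′ n → Permutation′ n
π↓ = C.π
π↑ = rev ∘ S.π ∘ rev

Θ-sym : x ≡Θ y → y ≡Θ x
Θ-sym = EqClosure.symmetric _

steps⇒Θ : Star C.Step y x → y ≡Θ x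
steps⇒Θ ε = ε
steps⇒Θ {y = y} (_◅_ {j = w} (a , d , drop , occ) steps) =
  fwd (inj₂ (drops⇒⟶ {y = y} {w} drop occ)) ◅ steps⇒Θ steps

rev-steps⇒Θ : Star S.Step y x → rev x ≡Θ rev y
rev-steps⇒Θ ε = ε
rev-steps⇒Θ {y = y} (_◅_ {j = w} (a , d , drop , occ) steps) =
  rev-steps⇒Θ steps ◅◅
  fwd (inj₂ (drops⇒⟶ {y = rev w} {rev y} (rev-drops {y = y} {w} drop) (rev-occurs {y = y} {w} drop occ))) ◅ ε

π↓-Θ : ∀ (x : Permutation′ n) → π↓ x ≡Θ x
π↓-Θ x = Θ-sym (steps⇒Θ (C.steps x))

π↑-Θ : ∀ (x : Permutation′ n) → π↑ x ≡Θ x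
π↑-Θ x = rev-steps⇒Θ (S.steps (rev x)) ◅◅ fwd (inj₁ (rev-involutive x)) ◅ ε

Θ-least : AvoidsAtDescents _>_ z → z ≡Θ y → z ⊑ y
Θ-least {z = z} {y = y} avoids z≡y = C.least {z = z} {y} avoids (proj₁ (Θ⇒⊆Θ z≡y))

Θ-greatest : AvoidsAtDescents _<_ (rev z) → z ≡Θ y → y ⊑ z
Θ-greatest {z = z} {y = y} avoids z≡y =
  rev-cancel {x = z} {y} (S.least {z = rev z} {rev y} avoids (proj₂ (Θ⇒⊆Θ z≡y)))

π↑-avoids : ∀ (x : Permutation′ n) → AvoidsAtDescents _<_ (rev (π↑ x))
π↑-avoids x = avoids-resp-≈ {x = S.π (rev x)} {y = rev (π↑ x)}
  (sym ∘ rev-involutive (S.π (rev x))) (S.π-avoids (rev x))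

isπ↓ : Isπ↓ (π↓ {n})
isπ↓ x = π↓-Θ x , λ y y≡x → ⊑⇒≤ʷ (Θ-least {z = π↓ x} {y} (C.π-avoids x) (π↓-Θ x ◅◅ Θ-sym y≡x))

isπ↑ : Isπ↑ (π↑ {n})
isπ↑ x = π↑-Θ x , λ y y≡x → ⊑⇒≤ʷ (Θ-greatest {z = π↑ x} {y} (π↑-avoids x) (π↑-Θ x ◅◅ Θ-sym y≡x))

-- `C.D` agrees at `π↓ x` and `x`, grows from `x` to `y`, and agrees at `y` and `π↓ y`; `C.least`
-- concludes.
π↓-mono : x ⊑ y → π↓ x ⊑ π↓ y
π↓-mono {x = x} {y = y} x⊑y = C.least {z = π↓ x} {π↓ y} (C.π-avoids x) λ a d a<d →
  proj₁ (Θ⇒⊆Θ (Θ-sym (π↓-Θ y))) a d a<d ∘ C.mono {x = x} {y} x⊑y a<d ∘ proj₁ (Θ⇒⊆Θ (π↓-Θ x)) a d a<d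

π↑-mono : x ⊑ y → π↑ x ⊑ π↑ y
π↑-mono {x = x} {y = y} x⊑y =
  rev-cancel {x = π↑ y} {π↑ x} (S.least {z = rev (π↑ y)} {rev (π↑ x)} (π↑-avoids y) λ a d a<d →
    proj₂ (Θ⇒⊆Θ (Θ-sym (π↑-Θ x))) a d a<d ∘ S.mono {x = rev y} {rev x} (rev-anti {x = x} {y} x⊑y) a<d ∘
    proj₂ (Θ⇒⊆Θ (π↑-Θ y)) a d a<d)

π↓-π↑ : AvoidsAtDescents _>_ z → π↓ (π↑ z) ≈ z
π↓-π↑ {z = z} avoids = ⊑-antisym {x = π↓ (π↑ z)} {z}
  (Θ-least {z = π↓ (π↑ z)} {z} (C.π-avoids (π↑ z)) equiv)
  (Θ-least {z = z} {π↓ (π↑ z)} avoids (Θ-sym equiv))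
  where equiv = π↓-Θ (π↑ z) ◅◅ π↑-Θ z

π↑-π↓ : AvoidsAtDescents _<_ (rev x) → π↑ (π↓ x) ≈ x
π↑-π↓ {x = x} avoids = ⊑-antisym {x = π↑ (π↓ x)} {x}
  (Θ-greatest {z = x} {π↑ (π↓ x)} avoids (Θ-sym equiv))
  (Θ-greatest {z = π↑ (π↓ x)} {x} (π↑-avoids (π↓ x)) equiv)
  where equiv = π↑-Θ (π↓ x) ◅◅ π↓-Θ x

-- Avoidance of 2-41-3 along a Θ₃₄₁₂-class

adjacent-unsplit : ∀ (w : Permutation′ n) {a d} → Adjacent w d a → Unsplit w d a
adjacent-unsplit w {a} {d} da g a<g g<d with Before? w d g
... | no ¬dg = inj₁ (¬before⇒after w (<⇒≢′ g<d) ¬dg)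
... | yes dg = inj₂ (¬before⇒after w (<⇒≢′ a<g) (λ ga → ℕ.<⇒≱ ga (⋖ₚ<⇒≤ da dg)))

-- Here `z` stands for the bottom of the class of `x`. The entries between `a` and `d` in value lie
-- on the same sides of a descent `d a` of `z` in `x` as in `z`. So `(a , d)` is unsplit in `x`, and
-- an occurrence in `z` would be one in `x`.
module BottomAvoids
  (x-avoids : AvoidsAtDescents _<_ x) (z-avoids : AvoidsAtDescents _>_ z)
  (z⊑x : z ⊑ x) (z⊆x : z C.⊆ᴰ x) (x⊆z : x C.⊆ᴰ z)
  {a d} (a<d : a < d) (da : Adjacent z d a)
  where

  unsplit : Unsplit z d a
  unsplit = adjacent-unsplit z da

  no-crossing : ∀ {b c} → a < b → b ≤ c → c < d → Before z a b → ¬ Before z c d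
  no-crossing a<b b≤c c<d ab cd = z-avoids a d a<d da
    (occurrence (ℕ.<-≤-trans a<b b≤c) c<d a<b (ℕ.≤-<-trans b≤c c<d) cd ab
      (≤∧≢⇒< b≤c λ { refl → ℕ.<-asym ab (ℕ.<-trans cd (⋖ₚ⇒< da)) }))

  -- If `v` preceded `a` in `x`, then `C.D x a v` would hold and pass to `z`, where `v` follows `a`.
  -- To verify it for `b ≤ c`: a `b` left of the descent in `z` precedes `a` in `x`; a `c` right of
  -- it follows `a` in `x` by induction; `no-crossing` excludes the remaining case.
  right-stays : ∀ v → a < v → v < d → Before z a v → Before x a v
  right-stays v = go v (<-wellFounded v)
    where
    go : ∀ v → Acc _<_ v → a < v → v < d → Before z a v → Before x a v
    go v (acc rs) a<v v<d av = ¬before⇒after x (<⇒≢′ a<v) λ va →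
      ℕ.<-asym av (C.before {w = z} (x⊆z a v a<v (va , split va)))
      where
      split : Before x v a → ∀ b c → a < b → b ≤ c → c < v → Before x b a ⊎ Before x v c
      split va b c a<b b≤c c<v with unsplit b a<b (ℕ.<-trans (ℕ.≤-<-trans b≤c c<v) v<d)
                                  | unsplit c (ℕ.<-≤-trans a<b b≤c) (ℕ.<-trans c<v v<d)
      ... | inj₁ bd | _ = inj₁ (z⊑x a b a<b (ℕ.<-trans bd (⋖ₚ⇒< da)))
      ... | inj₂ _  | inj₂ ac = inj₂ (ℕ.<-trans va
              (go c (rs c<v) (ℕ.<-≤-trans a<b b≤c) (ℕ.<-trans c<v v<d) ac))
      ... | inj₂ ab | inj₁ cd = contradiction cd (no-crossing a<b b≤c (ℕ.<-trans c<v v<d) ab)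

  -- The mirror image of `right-stays`, with the induction going down the values.
  left-stays : ∀ v → a < v → v < d → Before z v d → Before x v d
  left-stays v = go v (>-wellFounded v)
    where
    go : ∀ v → Acc _>_ v → a < v → v < d → Before z v d → Before x v d
    go v (acc rs) a<v v<d vd = ¬before⇒after x (<⇒≢′ v<d) λ dv →
      ℕ.<-asym vd (C.before {w = z} (x⊆z v d v<d (dv , split dv)))
      where
      split : Before x d v → ∀ b c → v < b → b ≤ c → c < d → Before x b v ⊎ Before x d c
      split dv b c v<b b≤c c<d with unsplit b (ℕ.<-trans a<v v<b) (ℕ.≤-<-trans b≤c c<d)
                                  | unsplit c (ℕ.<-trans a<v (ℕ.<-≤-trans v<b b≤c)) c<d
      ... | _ | inj₂ ac = inj₂ (z⊑x c d c<d (ℕ.<-trans (⋖ₚ⇒< da) ac))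
      ... | inj₁ bd | inj₁ _ = inj₁ (ℕ.<-trans
              (go b (rs v<b) (ℕ.<-trans a<v v<b) (ℕ.≤-<-trans b≤c c<d) bd) dv)
      ... | inj₂ ab | inj₁ cd = contradiction cd (no-crossing (ℕ.<-trans a<v v<b) b≤c c<d ab)

  unsplit-x : Unsplit x d a
  unsplit-x g a<g g<d = Sum.map (left-stays g a<g g<d) (right-stays g a<g g<d) (unsplit g a<g g<d)

  absent : ¬ Occurs _<_ z a d
  absent (occurrence a<l l<d a<r r<d l-d a-r l<r) =
    avoids-unsplit {w = x} x-avoids a<d (z⊑x a d a<d (⋖ₚ⇒< da)) unsplit-x
      (occurrence a<l l<d a<r r<d (left-stays _ a<l l<d l-d) (right-stays _ a<r r<d a-r) l<r)

-- Here `x` stands for the top of the class of `z`. An occurrence around a descent `d a` of `x` is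
-- narrowed to values `a′ < d′` satisfying `C.D x`, so that `(a′ , d′)` is an inversion of `z`. It
-- is shown to be unsplit in `z` and to carry an occurrence of 2-41-3 there.
module TopAvoids
  (x-top : AvoidsAtDescents _<_ (rev x)) (z-avoids : AvoidsAtDescents _<_ z)
  (z⊑x : z ⊑ x) (x⊆z : x C.⊆ᴰ z)
  {a d} (a<d : a < d) (da : Adjacent x d a)
  where

  no-3142 : ∀ {p q u v} → Adjacent x p q → p < v → v < u → u < q → Before x u p → ¬ Before x q v
  no-3142 pq p<v v<u u<q up qv =
    x-top _ _ (ℕ.<-trans p<v (ℕ.<-trans v<u u<q)) (opposite-⋖ₚ pq)
      (occurrence p<v (ℕ.<-trans v<u u<q) (ℕ.<-trans p<v v<u) u<q (before-rev x qv) (before-rev x up) v<u)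

  Left : Pred (Fin _) 0ℓ
  Left v = pos x v ≤ pos x d

  Left? : Decidable Left
  Left? v = pos x v ≤? pos x d

  right⇒ : ∀ v → ¬ Left v → pos x a ≤ pos x v
  right⇒ v = ⋖ₚ<⇒≤ da ∘ ℕ.≰⇒>

  -- Along the values, a′ is right of the descent d a, the block ]a′ , m] left of it,
  -- the block [m⁺ , d′[ right of it, and d′ left of it again.
  module Blocks {m m⁺ a′ d′ : Fin _} (m⋖m⁺ : m ⋖ₚ m⁺)
    (a≤a′ : a ≤ a′) (a′<m : a′ < m) (a′-right : ¬ Left a′) (left : ∀ t → a′ < t → t ≤ m → Left t)
    (m⁺<d′ : m⁺ < d′) (d′≤d : d′ ≤ d) (d′-left : Left d′) (right : ∀ t → m⁺ ≤ t → t < d′ → ¬ Left t)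
    where

    m<m⁺ : m < m⁺
    m<m⁺ = ⋖ₚ⇒< m⋖m⁺
    a<m : a < m
    a<m = ℕ.≤-<-trans a≤a′ a′<m
    m<d′ : m < d′
    m<d′ = ℕ.<-trans m<m⁺ m⁺<d′
    a′<d′ : a′ < d′
    a′<d′ = ℕ.<-trans a′<m m<d′
    a<m⁺ : a < m⁺
    a<m⁺ = ℕ.<-trans a<m m<m⁺
    m⁺<d : m⁺ < d
    m⁺<d = ℕ.<-≤-trans m⁺<d′ d′≤d
    d-m⁺ : Before x d m⁺
    d-m⁺ = ℕ.≰⇒> (right m⁺ ℕ.≤-refl m⁺<d′)

    d′-a′ : Before x d′ a′
    d′-a′ = ℕ.≤-<-trans d′-left (ℕ.≰⇒> a′-right)

    -- Suppose `d′` precedes `t`. From `t` to `d` the entries pass at some ascent `p q` from below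
    -- `m⁺` to at least `m⁺`. As the values from `m⁺` up to `d′` lie right of `d`, `q` exceeds `d′`.
    -- Then `d′ p q m⁺` is a 3-14-2.
    left-before : ∀ t → a′ < t → t ≤ m → Before x t d′
    left-before t a′<t t≤m = ¬before⇒after x (<⇒≢′ t<d′) impossible
      where
      t<d′ : t < d′
      t<d′ = ℕ.≤-<-trans t≤m m<d′
      t-d : Before x t d
      t-d = ≤∧≢⇒< (left t a′<t t≤m) λ eq → <⇒≢ (ℕ.<-≤-trans t<d′ d′≤d) (pos-injective x eq)
      impossible : ¬ Before x d′ t
      impossible d′t
        with p , q , pq , t≤p , q≤d , p<m⁺ , q≮m⁺ ←
          crossing-entries x (_<? m⁺) t-d (ℕ.≤-<-trans t≤m m<m⁺) (ℕ.<-asym m⁺<d)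
        = no-3142 pq p<m⁺ m⁺<d′ d′<q (ℕ.<-≤-trans d′t t≤p) (ℕ.≤-<-trans q≤d d-m⁺)
        where
        d′<q : d′ < q
        d′<q = ≤∧≢⇒< (ℕ.≮⇒≥ λ q<d′ → right q (ℕ.≮⇒≥ q≮m⁺) q<d′ q≤d)
                 λ { refl → ℕ.<-asym d′t (ℕ.≤-<-trans t≤p (⋖ₚ⇒< pq)) }

    -- The mirror image: between `a` and `t` there is an ascent `p q` for which `m p q a′` is a
    -- 3-14-2.
    right-after : ∀ t → m⁺ ≤ t → t < d′ → Before x a′ t
    right-after t m⁺≤t t<d′ = ¬before⇒after x (<⇒≢′ a′<t) impossible
      where
      a′<t : a′ < t
      a′<t = ℕ.<-trans a′<m (ℕ.<-≤-trans m<m⁺ m⁺≤t)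
      a-t : Before x a t
      a-t = ≤∧≢⇒< (right⇒ t (right t m⁺≤t t<d′)) λ eq → <⇒≢ (ℕ.≤-<-trans a≤a′ a′<t) (pos-injective x eq)
      impossible : ¬ Before x t a′
      impossible ta′
        with p , q , pq , a≤p , q≤t , p<m⁺ , q≮m⁺ ←
          crossing-entries x (_<? m⁺) a-t a<m⁺ (ℕ.≤⇒≯ m⁺≤t)
        = no-3142 pq p<a′ a′<m (ℕ.<-≤-trans m<m⁺ (ℕ.≮⇒≥ q≮m⁺))
            (ℕ.≤-<-trans (left m a′<m ℕ.≤-refl) (ℕ.<-≤-trans (⋖ₚ⇒< da) a≤p)) (ℕ.≤-<-trans q≤t ta′)
        where
        p<a′ : p < a′
        p<a′ = ≤∧≢⇒< (ℕ.≮⇒≥ λ a′<p → ℕ.<⇒≱ (ℕ.<-≤-trans (⋖ₚ⇒< da) a≤p) (left p a′<p (<⋖ₚ⇒≤ m⋖m⁺ p<m⁺)))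
                 λ { refl → ℕ.<-asym ta′ (ℕ.<-≤-trans (⋖ₚ⇒< pq) q≤t) }

    -- The cut is at `m⁺`: the left block precedes `a′`, which lies right of the descent, and the
    -- right block follows `d′`, which lies left of it.
    confined-x : C.D x a′ d′
    confined-x = d′-a′ , split
      where
      split : ∀ b c → a′ < b → b ≤ c → c < d′ → Before x b a′ ⊎ Before x d′ c
      split b c a′<b b≤c c<d′ with Left? b
      ... | yes b-left = inj₁ (ℕ.≤-<-trans b-left (ℕ.≰⇒> a′-right))
      ... | no b-right = inj₂ (ℕ.≤-<-trans d′-left (ℕ.≰⇒> (right c (ℕ.≤-trans m⁺≤b b≤c) c<d′)))
        where
        m⁺≤b : m⁺ ≤ b
        m⁺≤b = ℕ.≮⇒≥ λ b<m⁺ → b-right (left b a′<b (<⋖ₚ⇒≤ m⋖m⁺ b<m⁺))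

    left-before-z : ∀ t → a′ < t → t ≤ m → Before z t d′
    left-before-z t a′<t t≤m =
      ⊑-noninversion {x = z} {x} z⊑x (ℕ.≤-<-trans t≤m m<d′) (left-before t a′<t t≤m)

    right-after-z : ∀ t → m⁺ ≤ t → t < d′ → Before z a′ t
    right-after-z t m⁺≤t t<d′ =
      ⊑-noninversion {x = z} {x} z⊑x (ℕ.<-trans a′<m (ℕ.<-≤-trans m<m⁺ m⁺≤t)) (right-after t m⁺≤t t<d′)

    unsplit-z : Unsplit z d′ a′
    unsplit-z g a′<g g<d′ with g <? m⁺
    ... | yes g<m⁺ = inj₁ (left-before-z g a′<g (<⋖ₚ⇒≤ m⋖m⁺ g<m⁺))
    ... | no g≮m⁺  = inj₂ (right-after-z g (ℕ.≮⇒≥ g≮m⁺) g<d′)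

    impossible : ⊥
    impossible = avoids-unsplit {w = z} z-avoids a′<d′ (C.before {w = z} (x⊆z a′ d′ a′<d′ confined-x)) unsplit-z
      (occurrence a′<m m<d′ (ℕ.<-trans a′<m m<m⁺) m⁺<d′
        (left-before-z m a′<m ℕ.≤-refl) (right-after-z m⁺ ℕ.≤-refl m⁺<d′) m<m⁺)

  absent : ¬ Occurs _<_ x a d
  absent (occurrence a<l l<d a<r r<d l-d a-r l<r)
    -- Between `l` and `r` the values pass from the left side to the right side. The two blocks are
    -- then extended as far as they go; they stop inside the interval because `a` itself is on the
    -- right and `d` on the left.
    with m , m⁺ , m⋖m⁺ , l≤m , m⁺≤r , m-left , m⁺-right ←
      crossing Left? l<r (ℕ.<⇒≤ l-d) (ℕ.<⇒≱ (ℕ.<-trans (⋖ₚ⇒< da) a-r))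
    with a′ , a≤a′ , a′<m , a′-right , left ←
      lastHolding (¬? ∘ Left?) (ℕ.<-≤-trans a<l l≤m) (ℕ.<⇒≱ (⋖ₚ⇒< da)) (λ ¬m → ¬m m-left)
    with d′ , m⁺<d′ , d′≤d , d′-left , right ←
      firstFailing (¬? ∘ Left?) (ℕ.≤-<-trans m⁺≤r r<d) m⁺-right (λ ¬d → ¬d ℕ.≤-refl)
    = Blocks.impossible m⋖m⁺ a≤a′ a′<m a′-right (λ t a′<t t≤m → decidable-stable (Left? t) (left t a′<t t≤m))
        m⁺<d′ d′≤d (decidable-stable (Left? d′) d′-left) right

π↓-Baxter : Baxter x → TwistedBaxter (π↓ x)
π↓-Baxter {x = x} (_ , no-2413) =
  avoids-3-41-2⁺ (π↓ x) (C.π-avoids x) ,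
  avoids-2-41-3⁺ (π↓ x) λ a d → BottomAvoids.absent {x = x} {z = π↓ x} (avoids-2-41-3⁻ x no-2413) (C.π-avoids x)
    (Θ-least {z = π↓ x} {x} (C.π-avoids x) (π↓-Θ x))
    (proj₁ (Θ⇒⊆Θ (π↓-Θ x))) (proj₁ (Θ⇒⊆Θ (Θ-sym (π↓-Θ x))))

π↑-TwistedBaxter : TwistedBaxter x → Baxter (π↑ x)
π↑-TwistedBaxter {x = x} (_ , no-2413) =
  avoids-3-14-2⁺ (π↑ x) (π↑-avoids x) ,
  avoids-2-41-3⁺ (π↑ x) λ a d → TopAvoids.absent {x = π↑ x} {z = x} (π↑-avoids x) (avoids-2-41-3⁻ x no-2413)
    (Θ-greatest {z = π↑ x} {x} (π↑-avoids x) (π↑-Θ x))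
    (proj₁ (Θ⇒⊆Θ (π↑-Θ x)))

-- Joins

-- The descent starts at `reverse`, the top of the weak order and so an upper bound of any `x` and
-- `y`.
joinʷ : Op₂ (Permutation′ n)
joinʷ x y = proj₁ (Above.descend x y reverse)

module _ (x y : Permutation′ n) where

  open Above x y

  joinʷ-terminal : Terminal (joinʷ x y)
  joinʷ-terminal = proj₂ (proj₂ (descend reverse))

  joinʷ-above : x ⊑ joinʷ x y × y ⊑ joinʷ x y
  joinʷ-above = steps-above (proj₁ (proj₂ (descend reverse)))
    ((λ _ _ a<d _ → opposite-anti a<d) , (λ _ _ a<d _ → opposite-anti a<d))

  joinʷ-least : x ⊑ z → y ⊑ z → joinʷ x y ⊑ z
  joinʷ-least {z = z} = terminal-least {z = z} {joinʷ x y} joinʷ-terminal joinʷ-above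

  -- Each descent of the join is already an inversion of `x` or of `y`, so `join-avoids` applies to
  -- that one.
  joinʷ-avoids : ∀ {Q : Rel (Fin n) 0ℓ} → Detector Q →
                 AvoidsAtDescents Q x → AvoidsAtDescents Q y → AvoidsAtDescents Q (joinʷ x y)
  joinʷ-avoids det x-avoids y-avoids a d a<d da with terminal-descents {joinʷ x y} joinʷ-terminal a d a<d da
  ... | inj₁ xda = Detector.join-avoids det {z = x} {joinʷ x y} x-avoids (proj₁ joinʷ-above) a<d da xda
  ... | inj₂ yda = Detector.join-avoids det {z = y} {joinʷ x y} y-avoids (proj₂ joinʷ-above) a<d da yda

  joinʷ-TwistedBaxter : TwistedBaxter x → TwistedBaxter y → TwistedBaxter (joinʷ x y)
  joinʷ-TwistedBaxter (x₁ , x₂) (y₁ , y₂) =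
    avoids-3-41-2⁺ (joinʷ x y) (joinʷ-avoids confined (avoids-3-41-2⁻ x x₁) (avoids-3-41-2⁻ y y₁)) ,
    avoids-2-41-3⁺ (joinʷ x y) (joinʷ-avoids separated (avoids-2-41-3⁻ x x₂) (avoids-2-41-3⁻ y y₂))

-- The lattice of Baxter permutations

rev-Baxter : Baxter x → Baxter (rev x)
rev-Baxter {x = x} (x₁ , x₂) =
  avoids-3-14-2⁺ (rev x) (avoids-resp-≈ {x = x} {rev (rev x)} (sym ∘ rev-involutive x) (avoids-2-41-3⁻ x x₂)) ,
  avoids-2-41-3⁺ (rev x) (avoids-3-14-2⁻ x x₁)

BaxterPermutation : ℕ → Set
BaxterPermutation n = ∃ (Baxter {n})

reverseᴮ : BaxterPermutation n → BaxterPermutation n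
reverseᴮ (x , bx) = rev x , rev-Baxter {x = x} bx

infixr 6 _∨ᴮ_
infixr 7 _∧ᴮ_

_∨ᴮ_ _∧ᴮ_ : Op₂ (BaxterPermutation n)
(x , bx) ∨ᴮ (y , by) =
  π↑ (joinʷ (π↓ x) (π↓ y)) ,
  π↑-TwistedBaxter {x = joinʷ (π↓ x) (π↓ y)}
    (joinʷ-TwistedBaxter (π↓ x) (π↓ y) (π↓-Baxter {x = x} bx) (π↓-Baxter {x = y} by))
x ∧ᴮ y = reverseᴮ (reverseᴮ x ∨ᴮ reverseᴮ y)

π↑-π↓ᴮ : Baxter x → π↑ (π↓ x) ≈ x
π↑-π↓ᴮ {x = x} (x₁ , _) = π↑-π↓ {x = x} (avoids-3-14-2⁻ x x₁)

π↓-π↑ᵀ : TwistedBaxter x → π↓ (π↑ x) ≈ x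
π↓-π↑ᵀ {x = x} (x₁ , _) = π↓-π↑ {z = x} (avoids-3-41-2⁻ x x₁)

≤-π↑ : Baxter x → π↓ x ⊑ y → x ⊑ π↑ y
≤-π↑ {x = x} {y = y} bx π↓x⊑y = ⊑-trans {x = x} {π↑ (π↓ x)} {π↑ y}
  (⊑-reflexive {x = x} {π↑ (π↓ x)} (sym ∘ π↑-π↓ᴮ {x = x} bx)) (π↑-mono {x = π↓ x} {y} π↓x⊑y)

π↑-≤ : Baxter x → y ⊑ π↓ x → π↑ y ⊑ x
π↑-≤ {x = x} {y = y} bx y⊑π↓x = ⊑-trans {x = π↑ y} {π↑ (π↓ x)} {x}
  (π↑-mono {x = y} {π↓ x} y⊑π↓x) (⊑-reflexive {x = π↑ (π↓ x)} {x} (π↑-π↓ᴮ {x = x} bx))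

∨ᴮ-supremum : Supremum (_⊑_ ↾ Baxter {n}) _∨ᴮ_
∨ᴮ-supremum (x , bx) (y , by) =
  ≤-π↑ {x = x} {j} bx (proj₁ above) ,
  ≤-π↑ {x = y} {j} by (proj₂ above) ,
  λ { (z , bz) x⊑z y⊑z → π↑-≤ {x = z} {j} bz
        (joinʷ-least (π↓ x) (π↓ y) {z = π↓ z} (π↓-mono {x = x} {z} x⊑z) (π↓-mono {x = y} {z} y⊑z)) }
  where
  j = joinʷ (π↓ x) (π↓ y)
  above = joinʷ-above (π↓ x) (π↓ y)

⊑-rev : rev x ⊑ y → rev y ⊑ x
⊑-rev {x = x} {y = y} rx⊑y = ⊑-trans {x = rev y} {rev (rev x)} {x}
  (rev-anti {x = rev x} {y} rx⊑y) (⊑-reflexive {x = rev (rev x)} {x} (rev-involutive x))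

rev-⊑ : x ⊑ rev y → y ⊑ rev x
rev-⊑ {x = x} {y = y} x⊑ry = ⊑-trans {x = y} {rev (rev y)} {rev x}
  (⊑-reflexive {x = y} {rev (rev y)} (sym ∘ rev-involutive y)) (rev-anti {x = x} {rev y} x⊑ry)

∧ᴮ-infimum : Infimum (_⊑_ ↾ Baxter {n}) _∧ᴮ_
∧ᴮ-infimum x y =
  let j = reverseᴮ x ∨ᴮ reverseᴮ y
      rx≤j , ry≤j , j-least = ∨ᴮ-supremum (reverseᴮ x) (reverseᴮ y)
  in ⊑-rev {x = proj₁ x} {proj₁ j} rx≤j , ⊑-rev {x = proj₁ y} {proj₁ j} ry≤j ,
     λ z z⊑x z⊑y → rev-⊑ {x = proj₁ j} {proj₁ z} (j-least (reverseᴮ z)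
       (rev-anti {x = proj₁ z} {proj₁ x} z⊑x) (rev-anti {x = proj₁ z} {proj₁ y} z⊑y))

≤ʷ-isPartialOrder : ∀ (P : Pred (Permutation′ n) 0ℓ) → IsPartialOrder (_≈_ ↾ P) (_≤ʷ_ ↾ P)
≤ʷ-isPartialOrder P = record
  { isPreorder = record
    { isEquivalence = record
      { refl = λ _ → refl
      ; sym = sym ∘_
      ; trans = λ x≈y y≈z i → trans (x≈y i) (y≈z i)
      }
    ; reflexive = λ x≈y → inj₁ x≈y ◅ ε
    ; trans = _◅◅_
    }
  ; antisym = λ {x} {y} x≤y y≤x → ⊑-antisym {x = proj₁ x} {proj₁ y} (≤ʷ⇒⊑ x≤y) (≤ʷ⇒⊑ y≤x)
  }

Baxter-isLattice : IsLattice (_≈_ ↾ Baxter {n}) (_≤ʷ_ ↾ Baxter) _∨ᴮ_ _∧ᴮ_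
Baxter-isLattice = record
  { isPartialOrder = ≤ʷ-isPartialOrder Baxter
  ; supremum = λ x y → let x≤ , y≤ , least = ∨ᴮ-supremum x y in
      ⊑⇒≤ʷ x≤ , ⊑⇒≤ʷ y≤ , λ z x≤z y≤z → ⊑⇒≤ʷ (least z (≤ʷ⇒⊑ x≤z) (≤ʷ⇒⊑ y≤z))
  ; infimum = λ x y → let ≤x , ≤y , greatest = ∧ᴮ-infimum x y in
      ⊑⇒≤ʷ ≤x , ⊑⇒≤ʷ ≤y , λ z z≤x z≤y → ⊑⇒≤ʷ (greatest z (≤ʷ⇒⊑ z≤x) (≤ʷ⇒⊑ z≤y))
  }

-- The mutually inverse order isomorphisms

isOrderIsomorphism : ∀ {P P′ : Pred (Permutation′ n) 0ℓ} {f g : Permutation′ n → Permutation′ n}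
  (f-P : ∀ {x} → P x → P′ (f x)) (g-P : ∀ {x} → P′ x → P (g x)) →
  (∀ x y → x ⊑ y → f x ⊑ f y) → (∀ x y → x ⊑ y → g x ⊑ g y) →
  (∀ x → P x → g (f x) ≈ x) → (∀ x → P′ x → f (g x) ≈ x) →
  IsOrderIsomorphism (_≈_ ↾ P) (_≈_ ↾ P′) (_≤ʷ_ ↾ P) (_≤ʷ_ ↾ P′) (map f f-P)
isOrderIsomorphism {P = P} {P′} {f} {g} f-P g-P f-mono g-mono gf fg = record
  { isOrderMonomorphism = record
    { isOrderHomomorphism = record
      { cong = λ {x} {y} → f-cong (proj₁ x) (proj₁ y)
      ; mono = λ {x} {y} x≤y → ⊑⇒≤ʷ (f-mono (proj₁ x) (proj₁ y) (≤ʷ⇒⊑ x≤y))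
      }
    ; injective = λ {x} {y} fx≈fy → ⊑-antisym {x = proj₁ x} {proj₁ y}
        (f-cancel x y (⊑-reflexive {x = f (proj₁ x)} {f (proj₁ y)} fx≈fy))
        (f-cancel y x (⊑-reflexive {x = f (proj₁ y)} {f (proj₁ x)} (sym ∘ fx≈fy)))
    ; cancel = λ {x} {y} fx≤fy → ⊑⇒≤ʷ (f-cancel x y (≤ʷ⇒⊑ fx≤fy))
    }
  ; surjective = λ { (y , Py) → (g y , g-P Py) , λ { {z , _} z≈gy i →
      trans (f-cong z (g y) z≈gy i) (fg y Py i) } }
  }
  where
  f-cong : ∀ x y → x ≈ y → f x ≈ f y
  f-cong x y x≈y = ⊑-antisym {x = f x} {f y}
    (f-mono x y (⊑-reflexive {x = x} {y} x≈y)) (f-mono y x (⊑-reflexive {x = y} {x} (sym ∘ x≈y)))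

  f-cancel : (x y : ∃ P) → f (proj₁ x) ⊑ f (proj₁ y) → proj₁ x ⊑ proj₁ y
  f-cancel (x , Px) (y , Py) fx⊑fy = ⊑-trans {x = x} {g (f x)} {y}
    (⊑-reflexive {x = x} {g (f x)} (sym ∘ gf x Px))
    (⊑-trans {x = g (f x)} {g (f y)} {y} (g-mono (f x) (f y) fx⊑fy) (⊑-reflexive {x = g (f y)} {y} (gf y Py)))

corollary8p6 : (n : ℕ) → n ≥ 1 →
    (Σ[ π↓ ∈ (Permutation′ n → Permutation′ n) ] Σ[ π↑ ∈ (Permutation′ n → Permutation′ n) ]
    Isπ↓ π↓ × Isπ↑ π↑ ×
    Σ[ π↓-Baxter ∈ (∀ {x} → Baxter x → TwistedBaxter (π↓ x)) ]
    Σ[ π↑-Twisted ∈ (∀ {x} → TwistedBaxter x → Baxter (π↑ x)) ]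
    IsOrderIsomorphism (_≈_ ↾ Baxter) (_≈_ ↾ TwistedBaxter) (_≤ʷ_ ↾ Baxter) (_≤ʷ_ ↾ TwistedBaxter) (map π↓ π↓-Baxter) ×
    IsOrderIsomorphism (_≈_ ↾ TwistedBaxter) (_≈_ ↾ Baxter) (_≤ʷ_ ↾ TwistedBaxter) (_≤ʷ_ ↾ Baxter) (map π↑ π↑-Twisted) ×
    Inverseᵇ (_≈_ ↾ Baxter) (_≈_ ↾ TwistedBaxter) (map π↓ π↓-Baxter) (map π↑ π↑-Twisted))
    × (∃₂ λ _∨_ _∧_ → IsLattice (_≈_ ↾ Baxter {n}) (_≤ʷ_ ↾ Baxter) _∨_ _∧_)
corollary8p6 n _ =
  (π↓ , π↑ , isπ↓ , isπ↑ ,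
   (λ {x} → π↓-Baxter {x = x}) , (λ {x} → π↑-TwistedBaxter {x = x}) ,
   π↓-iso , π↑-iso ,
   -- Each surjectivity proof takes the image under the other map as preimage, so the two proofs are
   -- the two halves of `Inverseᵇ`.
   (λ {x} {y} y≈π↑x i → proj₂ (IsOrderIsomorphism.surjective π↓-iso x) {y} y≈π↑x i) ,
   (λ {x} {y} y≈π↓x i → proj₂ (IsOrderIsomorphism.surjective π↑-iso x) {y} y≈π↓x i)) ,
  _∨ᴮ_ , _∧ᴮ_ , Baxter-isLattice
  where
  π↓-iso = isOrderIsomorphism {P = Baxter} {TwistedBaxter} {π↓} {π↑}
    (λ {x} → π↓-Baxter {x = x}) (λ {x} → π↑-TwistedBaxter {x = x})
    (λ x y → π↓-mono {x = x} {y}) (λ x y → π↑-mono {x = x} {y}) (λ x → π↑-π↓ᴮ {x = x}) (λ x → π↓-π↑ᵀ {x = x})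
  π↑-iso = isOrderIsomorphism {P = TwistedBaxter} {Baxter} {π↑} {π↓}
    (λ {x} → π↑-TwistedBaxter {x = x}) (λ {x} → π↓-Baxter {x = x})
    (λ x y → π↑-mono {x = x} {y}) (λ x y → π↓-mono {x = x} {y}) (λ x → π↓-π↑ᵀ {x = x}) (λ x → π↑-π↓ᴮ {x = x})
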